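{- Let $R$ be a non-universal ceer. Then there are infinitely many pairwise $\leq$-incomparable dark ceers $(E_l)_{l\in\omega}$ such that for every $l$: $E_l\not\leq R$, and for every ceer $X$, if $X<E_l$ then $X\leq \mathrm{Id}_n$ for some $n\geq 1$.
   Context: A ceer is a computably enumerable equivalence relation on $\omega$. For equivalence relations $E,R$ on $\omega$, $E\leq R$ means there is a computable $f$ with $x\mathrel{E}y\iff f(x)\mathrel{R}f(y)$ for all $x,y$; $X<E$ means $X\leq E$ and $E\not\leq X$. A ceer is universal if every ceer is $\leq$ it. $\mathrm{Id}$ is equality on $\omega$ and, for $n\geq1$, $\mathrm{Id}_n$ is congruence modulo $n$ (a ceer with exactly $n$ classes). A ceer $R$ is dark if it has infinitely many classes and $\mathrm{Id}\not\leq R$. -}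

module Defs where

open import Data.Nat using (ℕ; zero; suc; _<_; NonZero)
open import Data.Nat.DivMod using (_%_)
open import Data.Fin using (Fin)
open import Data.Vec using (Vec; []; _∷_; lookup)
open import Data.List using (List)
open import Data.List.Relation.Unary.Any using (Any)
open import Data.Product using (Σ; _×_; ∃)
open import Relation.Binary.PropositionalEquality using (_≡_)
open import Relation.Binary.Structures using (IsEquivalence)
open import Relation.Nullary using (¬_)
open import Level using (0ℓ)
open import Axiom.ExcludedMiddle using (ExcludedMiddle)

data PR : ℕ → Set where
  cz   : ∀ {n} → PR n
  sc   : PR 1
  proj : ∀ {n} → Fin n → PR n
  comp : ∀ {n m} → PR m → Vec (PR n) m → PR n
  prec : ∀ {n} → PR n → PR (suc (suc n)) → PR (suc n)
  mu   : ∀ {n} → PR (suc n) → PR n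

mutual
  data _[_]⇓_ : ∀ {n} → PR n → Vec ℕ n → ℕ → Set where
    cz⇓   : ∀ {n} {xs : Vec ℕ n} → cz [ xs ]⇓ 0
    sc⇓   : ∀ {x} → sc [ x ∷ [] ]⇓ suc x
    proj⇓ : ∀ {n} {i : Fin n} {xs} → proj i [ xs ]⇓ lookup xs i
    comp⇓ : ∀ {n m} {f : PR m} {gs : Vec (PR n) m} {xs ys z} →
            gs [ xs ]⇓* ys → f [ ys ]⇓ z → comp f gs [ xs ]⇓ z
    prec0 : ∀ {n} {f : PR n} {g xs z} → f [ xs ]⇓ z → prec f g [ 0 ∷ xs ]⇓ z
    precS : ∀ {n} {f : PR n} {g xs k z w} →
            prec f g [ k ∷ xs ]⇓ z → g [ k ∷ z ∷ xs ]⇓ w →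
            prec f g [ suc k ∷ xs ]⇓ w
    mu⇓   : ∀ {n} {f : PR (suc n)} {xs k} →
            f [ k ∷ xs ]⇓ 0 →
            (∀ j → j < k → Σ ℕ λ v → f [ j ∷ xs ]⇓ suc v) →
            mu f [ xs ]⇓ k

  data _[_]⇓*_ : ∀ {n m} → Vec (PR n) m → Vec ℕ n → Vec ℕ m → Set where
    []⇓  : ∀ {n} {xs : Vec ℕ n} → [] [ xs ]⇓* []
    ∷⇓   : ∀ {n m} {g : PR n} {gs : Vec (PR n) m} {xs y ys} →
           g [ xs ]⇓ y → gs [ xs ]⇓* ys → (g ∷ gs) [ xs ]⇓* (y ∷ ys)

Computable : (ℕ → ℕ) → Set
Computable f = Σ (PR 1) λ c → ∀ x → c [ x ∷ [] ]⇓ f x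

BinRel : Set₁
BinRel = ℕ → ℕ → Set

CE : BinRel → Set
CE E = Σ (PR 2) λ c → ∀ x y →
         (E x y → ∃ λ z → c [ x ∷ y ∷ [] ]⇓ z) × ((∃ λ z → c [ x ∷ y ∷ [] ]⇓ z) → E x y)

Ceer : BinRel → Set
Ceer E = IsEquivalence E × CE E

_≤c_ : BinRel → BinRel → Set
E ≤c R = Σ (ℕ → ℕ) λ f → Computable f ×
           (∀ x y → (E x y → R (f x) (f y)) × (R (f x) (f y) → E x y))

_<c_ : BinRel → BinRel → Set
X <c E = X ≤c E × ¬ (E ≤c X)

Universal : BinRel → Set₁
Universal R = ∀ (X : BinRel) → Ceer X → X ≤c R

Id : BinRel
Id x y = x ≡ y

Idₙ : (n : ℕ) → .{{NonZero n}} → BinRel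
Idₙ n x y = x % n ≡ y % n

FinitelyManyClasses : BinRel → Set
FinitelyManyClasses R = Σ (List ℕ) λ xs → ∀ y → Any (λ x → R x y) xs

InfinitelyManyClasses : BinRel → Set
InfinitelyManyClasses R = ¬ FinitelyManyClasses R

Dark : BinRel → Set
Dark R = InfinitelyManyClasses R × ¬ (Id ≤c R)

-- classical logic (the paper's ambient logic)
LEM : Set₁
LEM = ExcludedMiddle 0ℓ

-- A ceer E with infinitely many classes such that every c.e. set meeting infinitely many
-- classes meets all of them is dark, and every X < E has finitely many classes: if f
-- reduces X to E and the range of f meets every class, then searching for preimages
-- reduces E to X. Such an E is built by finite injury. Requirement n = ⟨e , k⟩ merges an
-- output of φₑ into the class of k, at most once, provided that the class of the output is
-- not protected by a requirement m ≤ n; all requirements m > n then start afresh.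
--
-- E ≰ R is ensured by coding. Fix a ceer X ≰ R. Requirement n also holds a growing list
-- c₀, c₁, … of protected numbers and merges cᵢ with cⱼ when i X j; the list grows
-- only while φₑ looks like a reduction of E to R on it. If it grew forever, then i ↦ φₑ(cᵢ)
-- would reduce X to R. So every list is eventually finite, which both refutes φₑ and leaves
-- only finitely many classes protected against each requirement. The first entries c₀ of
-- the different lists witness infinitely many classes.
--
-- The sequence E₀, E₁, … is obtained by avoiding R and all previous Eₗ, which are not
-- universal because they are dark. Then Eₗ ≰ Eₘ also holds for l < m, by minimality of Eₘ.
module Submission where

open import Defs
open import Data.Nat
open import Data.Nat.DivMod using (_%_; m<n⇒m%n≡m)
open import Data.Nat.Induction using (<-rec)
open import Data.Nat.Properties
open import Data.Bool using (Bool; true; false; if_then_else_; T)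
open import Data.Fin using (Fin; zero; suc; toℕ; _↑ʳ_)
open import Data.Fin.Properties using (pigeonhole)
open import Data.Vec using (Vec; []; _∷_; lookup; tabulate)
open import Data.Vec.Properties using (tabulate∘lookup; tabulate-cong)
open import Data.List as List using (List; []; _∷_; _++_; foldr; length; drop)
open import Data.List.Membership.Propositional using (_∈_; _∉_; find; lose)
open import Data.List.Membership.Propositional.Properties using (∈-++⁺ˡ; ∈-++⁺ʳ)
open import Data.List.Relation.Unary.All using (All; []; _∷_)
open import Data.List.Relation.Unary.Any as Any using (Any; here; there)
open import Data.List.Relation.Unary.Any.Properties using (lookup-index)
open import Data.Product using (Σ; _×_; _,_; ∃; proj₁; proj₂)
open import Data.Sum using (_⊎_; inj₁; inj₂)
open import Function using (_∘_; case_of_; id; _$_)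
open import Relation.Binary.Definitions using (tri<; tri≈; tri>)
open import Relation.Binary.PropositionalEquality
open import Relation.Binary.Structures using (IsEquivalence)
open import Relation.Nullary using (¬_; yes; no; contradiction)
open import Relation.Nullary.Decidable using (decidable-stable)

-- Computability is given by derivations over `PR`, so every algorithm needs a code and a proof
-- about it. The construction is therefore written as terms of a small total language: proofs work
-- with their values, and compilation makes the stage function primitive recursive. Unbounded search
-- is left to the final reductions and enumerations. Limits are decided by excluded middle and enter
-- those programs as constants.
--
-- The obstacle in the coding is that `E` and `R` are only approximated: at one stage, `cᵢ E cⱼ` and
-- `φₑ(cᵢ) R φₑ(cⱼ)` may agree by accident. So each pair is compared again and again, with stage and
-- clock at least the current length; a list that grows forever has passed the comparison in the
-- limit. That `cᵢ E cⱼ` gives back `i X j` rests on an invariant: two protected numbers share a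
-- class only if they belong to one requirement and the coding allows it.
--
-- A merge is permanent, so a single one settles requirement n even if its own list is erased later.
-- This keeps the injuries finite.

-- Primitive recursion: a total fragment of `PR` with a functional semantics

data Prim : ℕ → Set where
  zr   : ∀ {n} → Prim n
  su   : Prim 1
  var  : ∀ {n} → Fin n → Prim n
  comp : ∀ {n m} → Prim m → Vec (Prim n) m → Prim n
  rec  : ∀ {n} → Prim n → Prim (suc (suc n)) → Prim (suc n)

natrec : ∀ {A : Set} → A → (ℕ → A → A) → ℕ → A
natrec z s zero    = z
natrec z s (suc k) = s k (natrec z s k)

mutual
  ⟦_⟧ₚ : ∀ {n} → Prim n → Vec ℕ n → ℕ
  ⟦ zr ⟧ₚ xs = 0
  ⟦ su ⟧ₚ (x ∷ []) = suc x
  ⟦ var i ⟧ₚ xs = lookup xs i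
  ⟦ comp f gs ⟧ₚ xs = ⟦ f ⟧ₚ (⟦ gs ⟧ₚ* xs)
  ⟦ rec f g ⟧ₚ (k ∷ xs) = natrec (⟦ f ⟧ₚ xs) (λ i a → ⟦ g ⟧ₚ (i ∷ a ∷ xs)) k

  ⟦_⟧ₚ* : ∀ {n m} → Vec (Prim n) m → Vec ℕ n → Vec ℕ m
  ⟦ [] ⟧ₚ* xs = []
  ⟦ g ∷ gs ⟧ₚ* xs = ⟦ g ⟧ₚ xs ∷ ⟦ gs ⟧ₚ* xs

mutual
  toPR : ∀ {n} → Prim n → PR n
  toPR zr = cz
  toPR su = sc
  toPR (var i) = proj i
  toPR (comp f gs) = comp (toPR f) (toPR* gs)
  toPR (rec f g) = prec (toPR f) (toPR g)

  toPR* : ∀ {n m} → Vec (Prim n) m → Vec (PR n) m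
  toPR* [] = []
  toPR* (g ∷ gs) = toPR g ∷ toPR* gs

mutual
  toPR-⇓ : ∀ {n} (p : Prim n) xs → toPR p [ xs ]⇓ ⟦ p ⟧ₚ xs
  toPR-⇓ zr xs = cz⇓
  toPR-⇓ su (x ∷ []) = sc⇓
  toPR-⇓ (var i) xs = proj⇓
  toPR-⇓ (comp f gs) xs = comp⇓ (toPR*-⇓ gs xs) (toPR-⇓ f _)
  toPR-⇓ (rec f g) (zero ∷ xs) = prec0 (toPR-⇓ f xs)
  toPR-⇓ (rec f g) (suc k ∷ xs) = precS (toPR-⇓ (rec f g) (k ∷ xs)) (toPR-⇓ g _)

  toPR*-⇓ : ∀ {n m} (ps : Vec (Prim n) m) xs → toPR* ps [ xs ]⇓* ⟦ ps ⟧ₚ* xs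
  toPR*-⇓ [] xs = []⇓
  toPR*-⇓ (p ∷ ps) xs = ∷⇓ (toPR-⇓ p xs) (toPR*-⇓ ps xs)

mutual
  -- Determinism on this fragment turns a derivation for a `mu` into the truth of its test at the
  -- value found.
  toPR-unique : ∀ {n} (p : Prim n) {xs z} → toPR p [ xs ]⇓ z → z ≡ ⟦ p ⟧ₚ xs
  toPR-unique zr cz⇓ = refl
  toPR-unique su sc⇓ = refl
  toPR-unique (var i) proj⇓ = refl
  toPR-unique (comp f gs) (comp⇓ ds d) with refl ← toPR*-unique gs ds = toPR-unique f d
  toPR-unique (rec f g) (prec0 d) = toPR-unique f d
  toPR-unique (rec f g) (precS d d′) with refl ← toPR-unique (rec f g) d = toPR-unique g d′

  toPR*-unique : ∀ {n m} (ps : Vec (Prim n) m) {xs zs} → toPR* ps [ xs ]⇓* zs → zs ≡ ⟦ ps ⟧ₚ* xs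
  toPR*-unique [] []⇓ = refl
  toPR*-unique (p ∷ ps) (∷⇓ d ds) = cong₂ _∷_ (toPR-unique p d) (toPR*-unique ps ds)

-- Renaming by projections: `vars id` passes all arguments on, `vars (3 ↑ʳ_)` forgets the first
-- three.
vars : ∀ {n m} → (Fin n → Fin m) → Vec (Prim m) n
vars {zero} f = []
vars {suc n} f = var (f zero) ∷ vars (f ∘ suc)

vars-eval : ∀ {n m} (f : Fin n → Fin m) (ys : Vec ℕ m) → ⟦ vars f ⟧ₚ* ys ≡ tabulate (lookup ys ∘ f)
vars-eval {zero} f ys = refl
vars-eval {suc n} f ys = cong (lookup ys (f zero) ∷_) (vars-eval (f ∘ suc) ys)

-- Arithmetic

pattern #0 = zero
pattern #1 = suc zero
pattern #2 = suc (suc zero)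
pattern #3 = suc (suc (suc zero))

const : ∀ {n} → ℕ → Prim n
const zero = zr
const (suc k) = comp su (const k ∷ [])

const-eval : ∀ {n} k (xs : Vec ℕ n) → ⟦ const k ⟧ₚ xs ≡ k
const-eval zero xs = refl
const-eval (suc k) xs = cong suc (const-eval k xs)

-- Case distinction as a recursion whose step ignores the accumulator: behind counter and
-- accumulator, `var #3` is `b`.
ifz : ∀ {n} → Prim n → Prim n → Prim n → Prim n
ifz c a b = comp (rec (var #0) (var #3)) (c ∷ a ∷ b ∷ [])

addP : Prim 2
addP = rec (var #0) (comp su (var #1 ∷ []))

add-eval : ∀ x y → ⟦ addP ⟧ₚ (x ∷ y ∷ []) ≡ x + y
add-eval zero y = refl
add-eval (suc x) y = cong suc (add-eval x y)

predP : Prim 1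
predP = rec zr (var #0)

pred-eval : ∀ x → ⟦ predP ⟧ₚ (x ∷ []) ≡ pred x
pred-eval zero = refl
pred-eval (suc x) = refl

-- Recursion runs on the first argument, so the subtrahend has to come first.
flipMonusP : Prim 2
flipMonusP = rec (var #0) (comp predP (var #1 ∷ []))

flipMonus-eval : ∀ y x → ⟦ flipMonusP ⟧ₚ (y ∷ x ∷ []) ≡ x ∸ y
flipMonus-eval zero x = refl
flipMonus-eval (suc y) x = begin
  ⟦ predP ⟧ₚ (⟦ flipMonusP ⟧ₚ (y ∷ x ∷ []) ∷ []) ≡⟨ pred-eval (⟦ flipMonusP ⟧ₚ (y ∷ x ∷ [])) ⟩
  pred (⟦ flipMonusP ⟧ₚ (y ∷ x ∷ []))            ≡⟨ cong pred (flipMonus-eval y x) ⟩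
  pred (x ∸ y)                                   ≡⟨ pred[m∸n]≡m∸[1+n] x y ⟩
  x ∸ suc y                                      ∎
  where open ≡-Reasoning

monus : ∀ {n} → Prim n → Prim n → Prim n
monus a b = comp flipMonusP (b ∷ a ∷ [])

bit : Bool → ℕ
bit true  = 1
bit false = 0

leqP : Prim 2
leqP = ifz (monus (var #0) (var #1)) (const 1) zr

leq-eval : ∀ x y → ⟦ leqP ⟧ₚ (x ∷ y ∷ []) ≡ bit (x ≤ᵇ y)
leq-eval x y rewrite flipMonus-eval y x = go x y
  where
  go : ∀ x y → natrec 1 (λ _ _ → 0) (x ∸ y) ≡ bit (x ≤ᵇ y)
  go zero zero = refl
  go zero (suc y) = refl
  go (suc x) zero = refl
  go (suc zero) (suc y) = go zero y
  go (suc (suc x)) (suc y) = go (suc x) y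

eqP : Prim 2
eqP = ifz (comp addP (monus (var #0) (var #1) ∷ monus (var #1) (var #0) ∷ [])) (const 1) zr

eq-eval : ∀ x y → ⟦ eqP ⟧ₚ (x ∷ y ∷ []) ≡ bit (x ≡ᵇ y)
eq-eval x y rewrite flipMonus-eval y x | flipMonus-eval x y | add-eval (x ∸ y) (y ∸ x) = go x y
  where
  go : ∀ x y → natrec 1 (λ _ _ → 0) ((x ∸ y) + (y ∸ x)) ≡ bit (x ≡ᵇ y)
  go zero zero = refl
  go zero (suc y) = refl
  go (suc x) zero = refl
  go (suc x) (suc y) = go x y

-- Cantor pairing

tri : ℕ → ℕ
tri zero    = 0
tri (suc n) = suc n + tri n

-- The diagonal of `z`, that is, the largest m with `tri m ≤ z`. From one number to the next it
-- rises by at most one, so primitive recursion replaces a search.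
root : ℕ → ℕ
root zero    = 0
root (suc z) = if tri (suc (root z)) ≤ᵇ suc z then suc (root z) else root z

tri-mono : ∀ {m n} → m ≤ n → tri m ≤ tri n
tri-mono z≤n = z≤n
tri-mono (s≤s p) = +-mono-≤ (s≤s p) (tri-mono p)

root-lower : ∀ z → tri (root z) ≤ z
root-lower zero = z≤n
root-lower (suc z) with tri (suc (root z)) ≤ᵇ suc z in eq
... | true  = ≤ᵇ⇒≤ _ _ (subst T (sym eq) _)
... | false = m≤n⇒m≤1+n (root-lower z)

root-upper : ∀ z → z < tri (suc (root z))
root-upper zero = s≤s z≤n
root-upper (suc z) with tri (suc (root z)) ≤ᵇ suc z in eq
... | true  = <-≤-trans (s≤s (root-upper z)) (s≤s (m≤n+m _ (suc (root z))))
... | false = ≰⇒> λ le → subst T eq (≤⇒≤ᵇ le)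

root-unique : ∀ m z → tri m ≤ z → z < tri (suc m) → root z ≡ m
root-unique m z lo hi with <-cmp (root z) m
... | tri< a _ _ = contradiction (≤-trans (tri-mono a) lo) (<⇒≱ (root-upper z))
... | tri≈ _ b _ = b
... | tri> _ _ c = contradiction (≤-trans (tri-mono c) (root-lower z)) (<⇒≱ hi)

n≤tri : ∀ n → n ≤ tri n
n≤tri zero = z≤n
n≤tri (suc n) = m≤m+n (suc n) _

triP : Prim 1
triP = rec zr (comp addP (comp su (var #0 ∷ []) ∷ var #1 ∷ []))

tri-eval : ∀ n → ⟦ triP ⟧ₚ (n ∷ []) ≡ tri n
tri-eval zero = refl
tri-eval (suc n) = trans (add-eval (suc n) (⟦ triP ⟧ₚ (n ∷ []))) (cong (suc n +_) (tri-eval n))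

πP : Prim 2
πP = comp addP (var #1 ∷ comp triP (addP ∷ []) ∷ [])

if-bit : ∀ b (x y : ℕ) → natrec y (λ _ _ → x) (bit b) ≡ (if b then x else y)
if-bit true x y = refl
if-bit false x y = refl

rootP : Prim 1
rootP = rec zr (ifz (comp leqP (comp triP (comp su (var #1 ∷ []) ∷ []) ∷ comp su (var #0 ∷ []) ∷ []))
                    (var #1) (comp su (var #1 ∷ [])))

root-eval : ∀ z → ⟦ rootP ⟧ₚ (z ∷ []) ≡ root z
root-eval zero = refl
root-eval (suc z)
  rewrite root-eval z | tri-eval (suc (root z)) | leq-eval (tri (suc (root z))) (suc z)
  = if-bit (tri (suc (root z)) ≤ᵇ suc z) (suc (root z)) (root z)

π₂P π₁P : Prim 1
π₂P = monus (var #0) (comp triP (rootP ∷ []))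
π₁P = monus rootP π₂P

opaque
  π : ℕ → ℕ → ℕ
  π x y = y + tri (x + y)

  π₂ π₁ : ℕ → ℕ
  π₂ z = z ∸ tri (root z)
  π₁ z = root z ∸ π₂ z

  root-π : ∀ x y → root (π x y) ≡ x + y
  root-π x y = root-unique (x + y) (π x y) (m≤n+m _ y) (s≤s (+-monoˡ-≤ (tri (x + y)) (m≤n+m y x)))

  π₂-π : ∀ x y → π₂ (π x y) ≡ y
  π₂-π x y rewrite root-π x y = m+n∸n≡m y (tri (x + y))

  π₁-π : ∀ x y → π₁ (π x y) ≡ x
  π₁-π x y rewrite π₂-π x y | root-π x y = m+n∸n≡m x y

  π₂≤root : ∀ z → π₂ z ≤ root z
  π₂≤root z = ≤-pred (begin-strict
    z ∸ tri (root z)                        <⟨ ∸-monoˡ-< (root-upper z) (root-lower z) ⟩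
    suc (root z) + tri (root z) ∸ tri (root z) ≡⟨ m+n∸n≡m (suc (root z)) (tri (root z)) ⟩
    suc (root z) ∎)
    where open ≤-Reasoning

  π-surj : ∀ z → π (π₁ z) (π₂ z) ≡ z
  π-surj z rewrite m∸n+n≡m (π₂≤root z) = m∸n+n≡m (root-lower z)

  +≤π : ∀ x y → x + y ≤ π x y
  +≤π x y = ≤-trans (n≤tri (x + y)) (m≤n+m _ y)

  x≤π : ∀ x y → x ≤ π x y
  x≤π x y = ≤-trans (m≤m+n x y) (+≤π x y)

  y≤π : ∀ x y → y ≤ π x y
  y≤π x y = m≤m+n y _

  π₁≤ : ∀ z → π₁ z ≤ z
  π₁≤ z = subst (π₁ z ≤_) (π-surj z) (x≤π _ (π₂ z))

  π₂≤ : ∀ z → π₂ z ≤ z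
  π₂≤ z = m∸n≤m z (tri (root z))

  π-zero : π 0 0 ≡ 0
  π-zero = refl

  π₂-zero : π₂ 0 ≡ 0
  π₂-zero = refl

  π-eval : ∀ x y → ⟦ πP ⟧ₚ (x ∷ y ∷ []) ≡ π x y
  π-eval x y = trans (add-eval y (⟦ triP ⟧ₚ (⟦ addP ⟧ₚ (x ∷ y ∷ []) ∷ []))) (cong (y +_) (trans (tri-eval (⟦ addP ⟧ₚ (x ∷ y ∷ []))) (cong tri (add-eval x y))))

  π₂-eval : ∀ z → ⟦ π₂P ⟧ₚ (z ∷ []) ≡ π₂ z
  π₂-eval z = trans (flipMonus-eval (⟦ triP ⟧ₚ (⟦ rootP ⟧ₚ (z ∷ []) ∷ [])) z)
    (cong (z ∸_) (trans (tri-eval (⟦ rootP ⟧ₚ (z ∷ []))) (cong tri (root-eval z))))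

  π₁-eval : ∀ z → ⟦ π₁P ⟧ₚ (z ∷ []) ≡ π₁ z
  π₁-eval z = trans (flipMonus-eval (⟦ π₂P ⟧ₚ (z ∷ [])) (⟦ rootP ⟧ₚ (z ∷ [])))
    (cong₂ _∸_ (root-eval z) (π₂-eval z))

-- Binary trees in bijection with the numbers

data Tree : Set where
  leaf : ℕ → Tree
  node : Tree → Tree → Tree

isLeaf : Tree → Bool
isLeaf (leaf _)   = true
isLeaf (node _ _) = false

val : Tree → ℕ
val (leaf n)   = n
val (node _ _) = 0

-- The default `leaf 0` has code 0, which is what the compiled selectors return on a leaf.
car cdr : Tree → Tree
car (leaf _)   = leaf 0
car (node a _) = a
cdr (leaf _)   = leaf 0
cdr (node _ b) = b

-- A first component 0 marks a leaf and a positive one a node, so every number is the code of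
-- exactly one tree.
encTree : Tree → ℕ
encTree (leaf n)   = π 0 n
encTree (node a b) = π (suc (encTree a)) (encTree b)

π-injective : ∀ {a b c d} → π a b ≡ π c d → a ≡ c × b ≡ d
π-injective {a} {b} {c} {d} e =
  trans (sym (π₁-π a b)) (trans (cong π₁ e) (π₁-π c d)) ,
  trans (sym (π₂-π a b)) (trans (cong π₂ e) (π₂-π c d))

encTree-injective : ∀ s t → encTree s ≡ encTree t → s ≡ t
encTree-injective (leaf m) (leaf n) e = cong leaf (proj₂ (π-injective {0} {m} {0} {n} e))
encTree-injective (leaf m) (node c d) e =
  contradiction (proj₁ (π-injective {0} {m} {suc (encTree c)} {encTree d} e)) λ ()
encTree-injective (node a b) (leaf n) e =
  contradiction (proj₁ (π-injective {suc (encTree a)} {encTree b} {0} {n} e)) λ ()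
encTree-injective (node a b) (node c d) e
  with p , q ← π-injective {suc (encTree a)} {encTree b} {suc (encTree c)} {encTree d} e
  = cong₂ node (encTree-injective a c (suc-injective p)) (encTree-injective b d q)

-- Because no number is left over, `toTree` is total and compiles to the identity, and every number
-- is a program code for the machine below.
encTree-surjective : ∀ n → Σ Tree λ t → encTree t ≡ n
encTree-surjective = <-rec _ go
  where
  go : ∀ n → (∀ {m} → m < n → Σ Tree λ t → encTree t ≡ m) → Σ Tree λ t → encTree t ≡ n
  go n ih with π₁ n in eq
  ... | zero  = leaf (π₂ n) , trans (cong (λ k → π k (π₂ n)) (sym eq)) (π-surj n)
  ... | suc a = node (proj₁ A) (proj₁ B) , trans (cong₂ π (trans (cong suc (proj₂ A)) (sym eq)) (proj₂ B)) (π-surj n)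
    where
    -- The positive first component makes both `a` and `π₂ n` strictly smaller than `n`.
    sum≤n : suc a + π₂ n ≤ n
    sum≤n = subst₂ _≤_ (cong (_+ π₂ n) eq) (π-surj n) (+≤π (π₁ n) (π₂ n))
    A = ih {a} (≤-trans (m≤m+n (suc a) (π₂ n)) sum≤n)
    B = ih {π₂ n} (≤-trans (s≤s (m≤n+m (π₂ n) a)) sum≤n)

toTree : ℕ → Tree
toTree n = proj₁ (encTree-surjective n)

enc-toTree : ∀ n → encTree (toTree n) ≡ n
enc-toTree n = proj₂ (encTree-surjective n)

toTree-enc : ∀ t → toTree (encTree t) ≡ t
toTree-enc t = encTree-injective _ t (enc-toTree (encTree t))

-- A typed language of total functions

infixr 6 _⊗_

data Ty : Set where
  nat bool tree : Ty
  _⊗_  : Ty → Ty → Ty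
  list : Ty → Ty

⟦_⟧ᵗ : Ty → Set
⟦ nat ⟧ᵗ    = ℕ
⟦ bool ⟧ᵗ   = Bool
⟦ tree ⟧ᵗ   = Tree
⟦ A ⊗ B ⟧ᵗ  = ⟦ A ⟧ᵗ × ⟦ B ⟧ᵗ
⟦ list A ⟧ᵗ = List ⟦ A ⟧ᵗ

encList : ∀ {X : Set} → (X → ℕ) → List X → ℕ
encList e []       = 0
encList e (x ∷ xs) = suc (π (e x) (encList e xs))

enc : ∀ A → ⟦ A ⟧ᵗ → ℕ
enc nat n           = n
enc bool b          = bit b
enc tree t          = encTree t
enc (A ⊗ B) (x , y) = π (enc A x) (enc B y)
enc (list A) xs     = encList (enc A) xs

Cx : Set
Cx = List Ty

data Var : Cx → Ty → Set where
  here  : ∀ {Γ A} → Var (A ∷ Γ) A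
  there : ∀ {Γ A B} → Var Γ A → Var (B ∷ Γ) A

Env : Cx → Set
Env = All ⟦_⟧ᵗ

-- A term has two readings, the Agda value `⟦_⟧` and the primitive recursive `compile` acting on
-- codes; `compile-eval` identifies them. `call` runs a body in its own context, so subprograms need
-- no renaming.
data Tm (Γ : Cx) : Ty → Set where
  var     : ∀ {A} → Var Γ A → Tm Γ A
  lit     : ∀ {A} → ⟦ A ⟧ᵗ → Tm Γ A
  call    : ∀ {Δ A} → Tm Δ A → All (Tm Γ) Δ → Tm Γ A
  suc′    : Tm Γ nat → Tm Γ nat
  natrec′ : ∀ {A} → Tm Γ nat → Tm Γ A → Tm (nat ∷ A ∷ Γ) A → Tm Γ A
  eqn     : Tm Γ nat → Tm Γ nat → Tm Γ bool
  leqn    : Tm Γ nat → Tm Γ nat → Tm Γ bool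
  ifb     : ∀ {A} → Tm Γ bool → Tm Γ A → Tm Γ A → Tm Γ A
  pair    : ∀ {A B} → Tm Γ A → Tm Γ B → Tm Γ (A ⊗ B)
  fst′    : ∀ {A B} → Tm Γ (A ⊗ B) → Tm Γ A
  snd′    : ∀ {A B} → Tm Γ (A ⊗ B) → Tm Γ B
  cons    : ∀ {A} → Tm Γ A → Tm Γ (list A) → Tm Γ (list A)
  foldr′  : ∀ {A B} → Tm Γ (list A) → Tm Γ B → Tm (A ∷ B ∷ Γ) B → Tm Γ B
  leaf′   : Tm Γ nat → Tm Γ tree
  node′   : Tm Γ tree → Tm Γ tree → Tm Γ tree
  isLeaf′ : Tm Γ tree → Tm Γ bool
  val′    : Tm Γ tree → Tm Γ nat
  car′    : Tm Γ tree → Tm Γ tree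
  cdr′    : Tm Γ tree → Tm Γ tree
  toTree′ : Tm Γ nat → Tm Γ tree
  π₁′     : Tm Γ nat → Tm Γ nat
  π₂′     : Tm Γ nat → Tm Γ nat

lookupᵉ : ∀ {Γ A} → Env Γ → Var Γ A → ⟦ A ⟧ᵗ
lookupᵉ (x ∷ ρ) here      = x
lookupᵉ (x ∷ ρ) (there i) = lookupᵉ ρ i

mutual
  ⟦_⟧ : ∀ {Γ A} → Tm Γ A → Env Γ → ⟦ A ⟧ᵗ
  ⟦ var i ⟧ ρ         = lookupᵉ ρ i
  ⟦ lit x ⟧ ρ         = x
  ⟦ call t ts ⟧ ρ     = ⟦ t ⟧ (⟦ ts ⟧* ρ)
  ⟦ suc′ t ⟧ ρ        = suc (⟦ t ⟧ ρ)
  ⟦ natrec′ n z s ⟧ ρ = natrec (⟦ z ⟧ ρ) (λ i a → ⟦ s ⟧ (i ∷ a ∷ ρ)) (⟦ n ⟧ ρ)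
  ⟦ eqn t u ⟧ ρ       = ⟦ t ⟧ ρ ≡ᵇ ⟦ u ⟧ ρ
  ⟦ leqn t u ⟧ ρ      = ⟦ t ⟧ ρ ≤ᵇ ⟦ u ⟧ ρ
  ⟦ ifb b t u ⟧ ρ     = if ⟦ b ⟧ ρ then ⟦ t ⟧ ρ else ⟦ u ⟧ ρ
  ⟦ pair t u ⟧ ρ      = ⟦ t ⟧ ρ , ⟦ u ⟧ ρ
  ⟦ fst′ t ⟧ ρ        = proj₁ (⟦ t ⟧ ρ)
  ⟦ snd′ t ⟧ ρ        = proj₂ (⟦ t ⟧ ρ)
  ⟦ cons t u ⟧ ρ      = ⟦ t ⟧ ρ ∷ ⟦ u ⟧ ρ
  ⟦ foldr′ l z s ⟧ ρ  = foldr (λ x a → ⟦ s ⟧ (x ∷ a ∷ ρ)) (⟦ z ⟧ ρ) (⟦ l ⟧ ρ)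
  ⟦ leaf′ t ⟧ ρ       = leaf (⟦ t ⟧ ρ)
  ⟦ node′ t u ⟧ ρ     = node (⟦ t ⟧ ρ) (⟦ u ⟧ ρ)
  ⟦ isLeaf′ t ⟧ ρ     = isLeaf (⟦ t ⟧ ρ)
  ⟦ val′ t ⟧ ρ        = val (⟦ t ⟧ ρ)
  ⟦ car′ t ⟧ ρ        = car (⟦ t ⟧ ρ)
  ⟦ cdr′ t ⟧ ρ        = cdr (⟦ t ⟧ ρ)
  ⟦ toTree′ t ⟧ ρ     = toTree (⟦ t ⟧ ρ)
  ⟦ π₁′ t ⟧ ρ         = π₁ (⟦ t ⟧ ρ)
  ⟦ π₂′ t ⟧ ρ         = π₂ (⟦ t ⟧ ρ)

  ⟦_⟧* : ∀ {Γ Δ} → All (Tm Γ) Δ → Env Γ → Env Δ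
  ⟦ [] ⟧* ρ     = []
  ⟦ t ∷ ts ⟧* ρ = ⟦ t ⟧ ρ ∷ ⟦ ts ⟧* ρ

-- Compilation of terms to primitive recursion on codes

index : ∀ {Γ A} → Var Γ A → Fin (length Γ)
index here      = zero
index (there i) = suc (index i)

encs : ∀ {Γ} → Env Γ → Vec ℕ (length Γ)
encs []              = []
encs {A ∷ _} (x ∷ ρ) = enc A x ∷ encs ρ

-- `π₂ (pred z)` is the tail of the list with code z and sends 0 to 0, so dropping past the end is
-- harmless.
dropP : Prim 2
dropP = rec (var #0) (comp π₂P (comp predP (var #1 ∷ []) ∷ []))

foldrRest : ∀ {n} → Prim (3 + n)
foldrRest = comp dropP (monus (var #2) (comp su (var #0 ∷ [])) ∷ var #2 ∷ [])

foldrBody : ∀ {n} → Prim n → Prim (suc (suc n)) → Prim (3 + n)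
foldrBody z s = ifz foldrRest (comp z (vars (3 ↑ʳ_)))
  (comp s (comp π₁P (comp predP (foldrRest ∷ []) ∷ []) ∷ var #1 ∷ vars (3 ↑ʳ_)))

-- `l` is passed twice, as the list and as the number of rounds: a list code is at least the length
-- of the list, so the rounds suffice.
foldrP : ∀ {n} → Prim n → Prim n → Prim (suc (suc n)) → Prim n
foldrP l z s = comp (rec (comp z (vars suc)) (foldrBody z s)) (l ∷ l ∷ vars id)

mutual
  compile : ∀ {Γ A} → Tm Γ A → Prim (length Γ)
  compile (var i)         = var (index i)
  compile (lit {A} x)     = const (enc A x)
  compile (call t ts)     = comp (compile t) (compile* ts)
  compile (suc′ t)        = comp su (compile t ∷ [])
  compile (natrec′ n z s) = comp (rec (compile z) (compile s)) (compile n ∷ vars id)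
  compile (eqn t u)       = comp eqP (compile t ∷ compile u ∷ [])
  compile (leqn t u)      = comp leqP (compile t ∷ compile u ∷ [])
  compile (ifb b t u)     = ifz (compile b) (compile u) (compile t)
  compile (pair t u)      = comp πP (compile t ∷ compile u ∷ [])
  compile (fst′ t)        = comp π₁P (compile t ∷ [])
  compile (snd′ t)        = comp π₂P (compile t ∷ [])
  compile (cons t u)      = comp su (comp πP (compile t ∷ compile u ∷ []) ∷ [])
  compile (foldr′ l z s)  = foldrP (compile l) (compile z) (compile s)
  compile (leaf′ t)       = comp πP (zr ∷ compile t ∷ [])
  compile (node′ t u)     = comp πP (comp su (compile t ∷ []) ∷ compile u ∷ [])
  compile (isLeaf′ t)     = ifz (comp π₁P (compile t ∷ [])) (const 1) zr
  compile (val′ t)        = ifz (comp π₁P (compile t ∷ [])) (comp π₂P (compile t ∷ [])) zr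
  compile (car′ t)        = comp predP (comp π₁P (compile t ∷ []) ∷ [])
  compile (cdr′ t)        = ifz (comp π₁P (compile t ∷ [])) zr (comp π₂P (compile t ∷ []))
  compile (toTree′ t)     = compile t
  compile (π₁′ t)         = comp π₁P (compile t ∷ [])
  compile (π₂′ t)         = comp π₂P (compile t ∷ [])

  compile* : ∀ {Γ Δ} → All (Tm Γ) Δ → Vec (Prim (length Γ)) (length Δ)
  compile* []       = []
  compile* (t ∷ ts) = compile t ∷ compile* ts

lookup-encs : ∀ {Γ A} (i : Var Γ A) (ρ : Env Γ) → lookup (encs ρ) (index i) ≡ enc A (lookupᵉ ρ i)
lookup-encs here      (x ∷ ρ) = refl
lookup-encs (there i) (x ∷ ρ) = lookup-encs i ρ

vars-id : ∀ {n} (xs : Vec ℕ n) → ⟦ vars id ⟧ₚ* xs ≡ xs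
vars-id xs = trans (vars-eval id xs) (tabulate∘lookup xs)

natrec-enc : ∀ {A} (z : ⟦ A ⟧ᵗ) (s : ℕ → ⟦ A ⟧ᵗ → ⟦ A ⟧ᵗ) (z′ : ℕ) (s′ : ℕ → ℕ → ℕ) →
  z′ ≡ enc A z → (∀ i a → s′ i (enc A a) ≡ enc A (s i a)) →
  ∀ n → natrec z′ s′ n ≡ enc A (natrec z s n)
natrec-enc z s z′ s′ hz hs zero    = hz
natrec-enc z s z′ s′ hz hs (suc n) = trans (cong (s′ n) (natrec-enc z s z′ s′ hz hs n)) (hs n _)

ifz-enc : ∀ A b (x y : ⟦ A ⟧ᵗ) → natrec (enc A y) (λ _ _ → enc A x) (bit b) ≡ enc A (if b then x else y)
ifz-enc A true  x y = refl
ifz-enc A false x y = refl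

module _ {X : Set} (e : X → ℕ) where

  length≤encList : ∀ xs → length xs ≤ encList e xs
  length≤encList []       = z≤n
  length≤encList (x ∷ xs) = s≤s (≤-trans (length≤encList xs) (y≤π (e x) _))

  drop-length≤ : ∀ k (xs : List X) → length xs ≤ k → drop k xs ≡ []
  drop-length≤ zero    []       p       = refl
  drop-length≤ (suc k) []       p       = refl
  drop-length≤ (suc k) (x ∷ xs) (s≤s p) = drop-length≤ k xs p

  drop-suc : ∀ k (xs : List X) → drop (suc k) xs ≡ drop 1 (drop k xs)
  drop-suc zero    xs       = refl
  drop-suc (suc k) []       = refl
  drop-suc (suc k) (x ∷ xs) = drop-suc k xs

  tail-eval : ∀ xs → π₂ (pred (encList e xs)) ≡ encList e (drop 1 xs)
  tail-eval []       = π₂-zero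
  tail-eval (x ∷ xs) = π₂-π (e x) (encList e xs)

  drop-eval : ∀ k xs → ⟦ dropP ⟧ₚ (k ∷ encList e xs ∷ []) ≡ encList e (drop k xs)
  drop-eval zero    xs = refl
  drop-eval (suc k) xs = begin
    ⟦ π₂P ⟧ₚ (⟦ predP ⟧ₚ (D ∷ []) ∷ [])   ≡⟨ π₂-eval (⟦ predP ⟧ₚ (D ∷ [])) ⟩
    π₂ (⟦ predP ⟧ₚ (D ∷ []))              ≡⟨ cong π₂ (pred-eval D) ⟩
    π₂ (pred D)                           ≡⟨ cong (π₂ ∘ pred) (drop-eval k xs) ⟩
    π₂ (pred (encList e (drop k xs)))     ≡⟨ tail-eval (drop k xs) ⟩
    encList e (drop 1 (drop k xs))        ≡⟨ cong (encList e) (sym (drop-suc k xs)) ⟩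
    encList e (drop (suc k) xs)           ∎
    where
    open ≡-Reasoning
    D = ⟦ dropP ⟧ₚ (k ∷ encList e xs ∷ [])

  module _ {Y : Set} (e′ : Y → ℕ) (f : X → Y → Y) (y : Y) (g : ℕ → ℕ → ℕ)
           (hg : ∀ x a → g (e x) (e′ a) ≡ e′ (f x a)) where

    stepN : ℕ → ℕ → ℕ
    stepN r a = natrec (e′ y) (λ _ _ → g (π₁ (pred r)) a) r

    stepN-eval : ∀ xs → stepN (encList e xs) (e′ (foldr f y (drop 1 xs))) ≡ e′ (foldr f y xs)
    stepN-eval []       = refl
    stepN-eval (x ∷ xs) = trans (cong (λ k → g k (e′ (foldr f y xs))) (π₁-π (e x) (encList e xs))) (hg x _)

    -- After i rounds the accumulator holds the fold of the last i entries, where the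
    -- list is thought of as padded to length N = its code.
    foldr-eval : ∀ xs (r : ℕ → ℕ) → (∀ i → r i ≡ encList e (drop (encList e xs ∸ suc i) xs)) →
      natrec (e′ y) (λ i a → stepN (r i) a) (encList e xs) ≡ e′ (foldr f y xs)
    foldr-eval xs r hr = trans (go N ≤-refl) (cong (λ k → e′ (foldr f y (drop k xs))) (n∸n≡0 N))
      where
      N = encList e xs
      go : ∀ i → i ≤ N → natrec (e′ y) (λ i a → stepN (r i) a) i ≡ e′ (foldr f y (drop (N ∸ i) xs))
      go zero    _   = cong (λ ys → e′ (foldr f y ys)) (sym (drop-length≤ N xs (length≤encList xs)))
      go (suc i) i<N = begin
        stepN (r i) (natrec (e′ y) (λ i a → stepN (r i) a) i)   ≡⟨ cong₂ stepN (hr i) (go i (<⇒≤ i<N)) ⟩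
        stepN (encList e ys) (e′ (foldr f y (drop (N ∸ i) xs))) ≡⟨ cong (λ zs → stepN (encList e ys) (e′ (foldr f y zs))) eq ⟩
        stepN (encList e ys) (e′ (foldr f y (drop 1 ys)))       ≡⟨ stepN-eval ys ⟩
        e′ (foldr f y ys)                                       ∎
        where
        open ≡-Reasoning
        ys = drop (N ∸ suc i) xs
        eq : drop (N ∸ i) xs ≡ drop 1 ys
        eq = trans (cong (λ k → drop k xs) (+-∸-assoc 1 i<N)) (drop-suc (N ∸ suc i) xs)

natrec-cong : ∀ {A : Set} {z z′ : A} {s s′ : ℕ → A → A} → z ≡ z′ → (∀ i a → s i a ≡ s′ i a) →
  ∀ n → natrec z s n ≡ natrec z′ s′ n
natrec-cong hz hs zero    = hz
natrec-cong {s′ = s′} hz hs (suc n) = trans (hs n _) (cong (s′ n) (natrec-cong hz hs n))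

mutual
  compile-eval : ∀ {Γ A} (t : Tm Γ A) (ρ : Env Γ) → ⟦ compile t ⟧ₚ (encs ρ) ≡ enc A (⟦ t ⟧ ρ)
  compile-eval (var i) ρ = lookup-encs i ρ
  compile-eval (lit {A} x) ρ = const-eval (enc A x) (encs ρ)
  compile-eval (call t ts) ρ = trans (cong ⟦ compile t ⟧ₚ (compile*-eval ts ρ)) (compile-eval t (⟦ ts ⟧* ρ))
  compile-eval (suc′ t) ρ = cong suc (compile-eval t ρ)
  compile-eval (natrec′ {A} n z s) ρ rewrite vars-id (encs ρ) | compile-eval n ρ =
    natrec-enc {A} (⟦ z ⟧ ρ) (λ i a → ⟦ s ⟧ (i ∷ a ∷ ρ)) _ _
      (compile-eval z ρ) (λ i a → compile-eval s (i ∷ a ∷ ρ)) (⟦ n ⟧ ρ)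
  compile-eval (eqn t u) ρ rewrite compile-eval t ρ | compile-eval u ρ = eq-eval (⟦ t ⟧ ρ) (⟦ u ⟧ ρ)
  compile-eval (leqn t u) ρ rewrite compile-eval t ρ | compile-eval u ρ = leq-eval (⟦ t ⟧ ρ) (⟦ u ⟧ ρ)
  compile-eval (ifb {A} b t u) ρ rewrite compile-eval b ρ | compile-eval t ρ | compile-eval u ρ =
    ifz-enc A (⟦ b ⟧ ρ) (⟦ t ⟧ ρ) (⟦ u ⟧ ρ)
  compile-eval (pair {A} {B} t u) ρ rewrite compile-eval t ρ | compile-eval u ρ =
    π-eval (enc A (⟦ t ⟧ ρ)) (enc B (⟦ u ⟧ ρ))
  compile-eval (fst′ {A} {B} t) ρ rewrite compile-eval t ρ =
    trans (π₁-eval (enc (A ⊗ B) (⟦ t ⟧ ρ))) (π₁-π (enc A (proj₁ (⟦ t ⟧ ρ))) (enc B (proj₂ (⟦ t ⟧ ρ))))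
  compile-eval (snd′ {A} {B} t) ρ rewrite compile-eval t ρ =
    trans (π₂-eval (enc (A ⊗ B) (⟦ t ⟧ ρ))) (π₂-π (enc A (proj₁ (⟦ t ⟧ ρ))) (enc B (proj₂ (⟦ t ⟧ ρ))))
  compile-eval (cons {A} t u) ρ rewrite compile-eval t ρ | compile-eval u ρ =
    cong suc (π-eval (enc A (⟦ t ⟧ ρ)) (encList (enc A) (⟦ u ⟧ ρ)))
  compile-eval (foldr′ {A} {B} l z s) ρ =
    foldrP-eval {A = A} {B} (compile l) (compile z) (compile s) (encs ρ)
      (⟦ l ⟧ ρ) (⟦ z ⟧ ρ) (λ x a → ⟦ s ⟧ (x ∷ a ∷ ρ))
      (compile-eval l ρ) (compile-eval z ρ) (λ x a → compile-eval s (x ∷ a ∷ ρ))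
  compile-eval (leaf′ t) ρ rewrite compile-eval t ρ = π-eval 0 (⟦ t ⟧ ρ)
  compile-eval (node′ t u) ρ rewrite compile-eval t ρ | compile-eval u ρ =
    π-eval (suc (encTree (⟦ t ⟧ ρ))) (encTree (⟦ u ⟧ ρ))
  compile-eval (isLeaf′ t) ρ rewrite compile-eval t ρ | π₁-eval (encTree (⟦ t ⟧ ρ)) with ⟦ t ⟧ ρ
  ... | leaf n rewrite π₁-π 0 n = refl
  ... | node a b rewrite π₁-π (suc (encTree a)) (encTree b) = refl
  compile-eval (val′ t) ρ
    rewrite compile-eval t ρ | π₁-eval (encTree (⟦ t ⟧ ρ)) | π₂-eval (encTree (⟦ t ⟧ ρ)) with ⟦ t ⟧ ρ
  ... | leaf n rewrite π₁-π 0 n = π₂-π 0 n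
  ... | node a b rewrite π₁-π (suc (encTree a)) (encTree b) = refl
  compile-eval (car′ t) ρ rewrite compile-eval t ρ | π₁-eval (encTree (⟦ t ⟧ ρ)) with ⟦ t ⟧ ρ
  ... | leaf n rewrite π₁-π 0 n = sym π-zero
  ... | node a b rewrite π₁-π (suc (encTree a)) (encTree b) = refl
  compile-eval (cdr′ t) ρ
    rewrite compile-eval t ρ | π₁-eval (encTree (⟦ t ⟧ ρ)) | π₂-eval (encTree (⟦ t ⟧ ρ)) with ⟦ t ⟧ ρ
  ... | leaf n rewrite π₁-π 0 n = sym π-zero
  ... | node a b rewrite π₁-π (suc (encTree a)) (encTree b) = π₂-π (suc (encTree a)) (encTree b)
  compile-eval (toTree′ t) ρ = trans (compile-eval t ρ) (sym (enc-toTree (⟦ t ⟧ ρ)))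
  compile-eval (π₁′ t) ρ rewrite compile-eval t ρ = π₁-eval (⟦ t ⟧ ρ)
  compile-eval (π₂′ t) ρ rewrite compile-eval t ρ = π₂-eval (⟦ t ⟧ ρ)

  compile*-eval : ∀ {Γ Δ} (ts : All (Tm Γ) Δ) (ρ : Env Γ) → ⟦ compile* ts ⟧ₚ* (encs ρ) ≡ encs (⟦ ts ⟧* ρ)
  compile*-eval [] ρ = refl
  compile*-eval (t ∷ ts) ρ = cong₂ _∷_ (compile-eval t ρ) (compile*-eval ts ρ)

  foldrP-eval : ∀ {n A B} (l z : Prim n) (s : Prim (2 + n)) (xs : Vec ℕ n)
    (ls : List ⟦ A ⟧ᵗ) (y : ⟦ B ⟧ᵗ) (f : ⟦ A ⟧ᵗ → ⟦ B ⟧ᵗ → ⟦ B ⟧ᵗ) →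
    ⟦ l ⟧ₚ xs ≡ encList (enc A) ls → ⟦ z ⟧ₚ xs ≡ enc B y →
    (∀ x a → ⟦ s ⟧ₚ (enc A x ∷ enc B a ∷ xs) ≡ enc B (f x a)) →
    ⟦ foldrP l z s ⟧ₚ xs ≡ enc B (foldr f y ls)
  foldrP-eval {A = A} {B} l z s xs ls y f hl hz hs
    rewrite hl | vars-id xs
    = trans (natrec-cong base body N)
        (foldr-eval (enc A) (enc B) f y (λ x a → ⟦ s ⟧ₚ (x ∷ a ∷ xs)) hs ls r hr)
    where
    N = encList (enc A) ls
    shift : ∀ {m} (g : Fin _ → Fin m) ys → (∀ i → lookup ys (g i) ≡ lookup xs i) → ⟦ vars g ⟧ₚ* ys ≡ xs
    shift g ys h = trans (vars-eval g ys) (trans (tabulate-cong h) (tabulate∘lookup xs))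
    base : ⟦ z ⟧ₚ (⟦ vars suc ⟧ₚ* (N ∷ xs)) ≡ enc B y
    base = trans (cong ⟦ z ⟧ₚ (shift suc (N ∷ xs) (λ _ → refl))) hz
    r : ℕ → ℕ
    r i = ⟦ dropP ⟧ₚ (⟦ flipMonusP ⟧ₚ (suc i ∷ N ∷ []) ∷ N ∷ [])
    hr : ∀ i → r i ≡ encList (enc A) (drop (N ∸ suc i) ls)
    hr i = trans (cong (λ k → ⟦ dropP ⟧ₚ (k ∷ N ∷ [])) (flipMonus-eval (suc i) N)) (drop-eval (enc A) (N ∸ suc i) ls)
    body : ∀ i a → ⟦ foldrBody z s ⟧ₚ (i ∷ a ∷ N ∷ xs) ≡
                   stepN (enc A) (enc B) f y (λ x a → ⟦ s ⟧ₚ (x ∷ a ∷ xs)) hs (r i) a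
    body i a = natrec-cong
      (trans (cong ⟦ z ⟧ₚ sh) hz)
      (λ _ _ → cong ⟦ s ⟧ₚ (cong₂ (λ h t → h ∷ a ∷ t)
        (trans (π₁-eval (⟦ predP ⟧ₚ (r i ∷ []))) (cong π₁ (pred-eval (r i)))) sh))
      (r i)
      where
      sh = shift (3 ↑ʳ_) (i ∷ a ∷ N ∷ xs) (λ _ → refl)

pattern v0 = var here
pattern v1 = var (there here)
pattern v2 = var (there (there here))
pattern v3 = var (there (there (there here)))
pattern v4 = var (there (there (there (there here))))
pattern v5 = var (there (there (there (there (there here)))))
pattern v6 = var (there (there (there (there (there (there here))))))

-- Computability of terms and unbounded search

Tm-computable : (t : Tm (nat ∷ []) nat) → Computable (λ x → ⟦ t ⟧ (x ∷ []))
Tm-computable t = toPR (compile t) ,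
  λ x → subst (toPR (compile t) [ x ∷ [] ]⇓_) (compile-eval t (x ∷ [])) (toPR-⇓ (compile t) _)

∘-computable : ∀ {f g} → Computable f → Computable g → Computable (f ∘ g)
∘-computable {g = g} (c , hc) (d , hd) = comp c (d ∷ []) , λ x → comp⇓ (∷⇓ (hd x) []⇓) (hc (g x))

least : (p : ℕ → Bool) → ∀ n → p n ≡ true → Σ ℕ λ m → p m ≡ true × (∀ j → j < m → p j ≡ false)
least p zero h = 0 , h , λ _ ()
least p (suc n) h with p 0 in eq
... | true  = 0 , eq , λ _ ()
... | false with m , hm , below ← least (p ∘ suc) n h =
  suc m , hm , λ { zero _ → eq ; (suc j) (s≤s j<m) → below j j<m }

module _ {Γ} (t : Tm (nat ∷ Γ) bool) where

  -- Minimisation looks for a zero, so truth becomes 0 and falsity 1.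
  refuted : Prim (suc (length Γ))
  refuted = compile (ifb t (lit {A = nat} 0) (lit 1))

  refuted-eval : ∀ s ρ → ⟦ refuted ⟧ₚ (s ∷ encs ρ) ≡ (if ⟦ t ⟧ (s ∷ ρ) then 0 else 1)
  refuted-eval s ρ = compile-eval (ifb t (lit 0) (lit 1)) (s ∷ ρ)

  μ-search : ∀ ρ n → ⟦ t ⟧ (n ∷ ρ) ≡ true → Σ ℕ λ m → mu (toPR refuted) [ encs ρ ]⇓ m × ⟦ t ⟧ (m ∷ ρ) ≡ true
  μ-search ρ n h with m , hm , below ← least (λ s → ⟦ t ⟧ (s ∷ ρ)) n h =
    m , mu⇓ (value m hm) (λ j j<m → 0 , value j (below j j<m)) , hm
    where
    value : ∀ s {b} → ⟦ t ⟧ (s ∷ ρ) ≡ b → toPR refuted [ s ∷ encs ρ ]⇓ (if b then 0 else 1)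
    value s refl = subst (toPR refuted [ s ∷ encs ρ ]⇓_) (refuted-eval s ρ) (toPR-⇓ refuted _)

  μ-sound : ∀ ρ {m} → mu (toPR refuted) [ encs ρ ]⇓ m → ⟦ t ⟧ (m ∷ ρ) ≡ true
  μ-sound ρ {m} (mu⇓ d _) with ⟦ t ⟧ (m ∷ ρ) | trans (toPR-unique refuted d) (refuted-eval m ρ)
  ... | true  | _ = refl
  ... | false | ()

opaque
  -- Existence may have been obtained classically: the witness only guarantees that minimisation
  -- halts, and the value it finds depends computably on x.
  search : (t : Tm (nat ∷ nat ∷ []) bool) → (∀ x → ∃ λ s → ⟦ t ⟧ (s ∷ x ∷ []) ≡ true) →
    Σ (ℕ → ℕ) λ g → Computable g × (∀ x → ⟦ t ⟧ (g x ∷ x ∷ []) ≡ true)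
  search t total = (λ x → proj₁ (found x)) , (mu (toPR (refuted t)) , λ x → proj₁ (proj₂ (found x))) ,
    λ x → proj₂ (proj₂ (found x))
    where
    found : ∀ x → Σ ℕ λ m → mu (toPR (refuted t)) [ x ∷ [] ]⇓ m × ⟦ t ⟧ (m ∷ x ∷ []) ≡ true
    found x = μ-search t (x ∷ []) (proj₁ (total x)) (proj₂ (total x))

  ∃-CE : (t : Tm (nat ∷ nat ∷ nat ∷ []) bool) → CE (λ x y → ∃ λ s → ⟦ t ⟧ (s ∷ x ∷ y ∷ []) ≡ true)
  ∃-CE t = mu (toPR (refuted t)) , λ x y →
    (λ (s , h) → let m , d , _ = μ-search t (x ∷ y ∷ []) s h in m , d) ,
    (λ (m , d) → m , μ-sound t (x ∷ y ∷ []) d)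

-- A universal stack machine

frame : ∀ {Γ} → ℕ → Tm Γ tree → Tm Γ tree
frame n d = node′ (lit (leaf n)) d

nil′ : ∀ {Γ} → Tm Γ tree
nil′ = lit (leaf 0)

suc-leaf pred-leaf : ∀ {Γ} → Tm Γ tree → Tm Γ tree
suc-leaf t = leaf′ (suc′ (val′ t))
pred-leaf t = leaf′ (natrec′ (val′ t) (lit 0) v0)

-- Frames with tags 0 to 5 are program codes waiting to be run on the current value; 6 and 7
-- evaluate the arguments of a composition, 8 collects their values, 9 resumes a primitive
-- recursion and 10 a minimisation.
-- The parameters are the tag and the data of the top frame, the rest of the stack, and the current value.
dispatch : Tm (nat ∷ tree ∷ tree ∷ tree ∷ []) tree
dispatch =
  ifb (tag 0) (node′ K nil′) $
  ifb (tag 1) (node′ K (suc-leaf (car′ v))) $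
  ifb (tag 2) (ifb (isLeaf′ d) (node′ K (car′ v))
    (node′ (node′ (frame 2 (cdr′ d)) K) (cdr′ v))) $
  ifb (tag 3) (node′ (node′ (frame 6 (node′ (car′ d) v)) (node′ (cdr′ d) K)) nil′) $
  ifb (tag 4) (ifb (eqn (val′ (car′ v)) (lit 0)) (node′ (node′ (car′ d) K) (cdr′ v))
    (node′ (node′ (frame 4 d) (node′ (frame 9 (node′ (cdr′ d) (node′ (pred-leaf (car′ v)) (cdr′ v)))) K))
           (node′ (pred-leaf (car′ v)) (cdr′ v)))) $
  ifb (tag 5) (node′ (node′ d (node′ (frame 10 (node′ d (node′ nil′ v))) K)) (node′ nil′ v)) $
  -- Arguments are evaluated from the last to the first, so that frame 8 can put the value of the
  -- head in front of the values already collected.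
  ifb (tag 6) (ifb (isLeaf′ (car′ d)) (node′ K nil′)
    (node′ (node′ (frame 6 (node′ (cdr′ (car′ d)) (cdr′ d)))
                  (node′ (frame 7 (node′ (car′ (car′ d)) (cdr′ d))) K)) nil′)) $
  ifb (tag 7) (node′ (node′ (car′ d) (node′ (frame 8 v) K)) (cdr′ d)) $
  ifb (tag 8) (node′ K (node′ v d)) $
  ifb (tag 9) (node′ (node′ (car′ d) K) (node′ (car′ (cdr′ d)) (node′ v (cdr′ (cdr′ d))))) $
  ifb (eqn (val′ v) (lit 0)) (node′ K (car′ (cdr′ d)))
    (node′ (node′ (car′ d) (node′ (frame 10 (node′ (car′ d) (node′ j (cdr′ (cdr′ d))))) K))
           (node′ j (cdr′ (cdr′ d))))
  where
  tag : ℕ → Tm (nat ∷ tree ∷ tree ∷ tree ∷ []) bool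
  tag n = eqn v0 (lit n)
  d K v j : Tm (nat ∷ tree ∷ tree ∷ tree ∷ []) tree
  d = v1
  K = v2
  v = v3
  j = suc-leaf (car′ (cdr′ d))

-- A state pairs the stack with the current value. With an empty stack, which is a leaf, it is a
-- fixed point; hence a halted run stays the same under a larger clock.
stepᵐ′ : Tm (tree ∷ []) tree
stepᵐ′ = ifb (isLeaf′ (car′ v0)) v0
  (call dispatch (val′ (car′ (car′ (car′ v0))) ∷ cdr′ (car′ (car′ v0)) ∷ cdr′ (car′ v0) ∷ cdr′ v0 ∷ []))

stepᵐ : Tree → Tree
stepᵐ σ = ⟦ stepᵐ′ ⟧ (σ ∷ [])

run′ : Tm (nat ∷ tree ∷ []) tree
run′ = natrec′ v0 v1 (call stepᵐ′ (v1 ∷ []))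

iter : ∀ {X : Set} → (X → X) → ℕ → X → X
iter f t x = natrec x (λ _ → f) t

iter-suc : ∀ {X : Set} (f : X → X) t x → iter f (suc t) x ≡ iter f t (f x)
iter-suc f zero    x = refl
iter-suc f (suc t) x = cong f (iter-suc f t x)

iter-fixed : ∀ {X : Set} (f : X → X) {t t′} x → t ≤′ t′ → f (iter f t x) ≡ iter f t x → iter f t′ x ≡ iter f t x
iter-fixed f x ≤′-refl     h = refl
iter-fixed f x (≤′-step p) h = trans (cong f (iter-fixed f x p h)) h

run : ℕ → Tree → Tree
run = iter stepᵐ

run-suc : ∀ t σ → run (suc t) σ ≡ run t (stepᵐ σ)
run-suc = iter-suc stepᵐ

⌜_⌝ᶠ : ∀ {n} → Fin n → Tree
⌜ zero ⌝ᶠ  = leaf 0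
⌜ suc i ⌝ᶠ = node (leaf 0) ⌜ i ⌝ᶠ

mutual
  ⌜_⌝ : ∀ {n} → PR n → Tree
  ⌜ cz ⌝        = node (leaf 0) (leaf 0)
  ⌜ sc ⌝        = node (leaf 1) (leaf 0)
  ⌜ proj i ⌝    = node (leaf 2) ⌜ i ⌝ᶠ
  ⌜ comp f gs ⌝ = node (leaf 3) (node ⌜ gs ⌝* ⌜ f ⌝)
  ⌜ prec f g ⌝  = node (leaf 4) (node ⌜ f ⌝ ⌜ g ⌝)
  ⌜ mu f ⌝      = node (leaf 5) ⌜ f ⌝

  ⌜_⌝* : ∀ {n m} → Vec (PR n) m → Tree
  ⌜ [] ⌝*     = leaf 0
  ⌜ g ∷ gs ⌝* = node ⌜ g ⌝ ⌜ gs ⌝*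

⌜_⌝ᵛ : ∀ {n} → Vec ℕ n → Tree
⌜ [] ⌝ᵛ     = leaf 0
⌜ x ∷ xs ⌝ᵛ = node (leaf x) ⌜ xs ⌝ᵛ

data _↝_ : Tree → Tree → Set where
  stop : ∀ {σ} → σ ↝ σ
  next : ∀ {σ τ} → stepᵐ σ ↝ τ → σ ↝ τ

_⊙_ : ∀ {ρ σ τ} → ρ ↝ σ → σ ↝ τ → ρ ↝ τ
stop ⊙ q = q
next p ⊙ q = next (p ⊙ q)

opaque
  ↝⇒run : ∀ {σ τ} → σ ↝ τ → ∃ λ t → run t σ ≡ τ
  ↝⇒run stop = 0 , refl
  ↝⇒run {σ} (next p) with t , h ← ↝⇒run p = suc t , trans (run-suc t σ) h

proj-runs : ∀ {n} (i : Fin n) xs K → node (node (node (leaf 2) ⌜ i ⌝ᶠ) K) ⌜ xs ⌝ᵛ ↝ node K (leaf (lookup xs i))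
proj-runs zero    (x ∷ xs) K = next stop
proj-runs (suc i) (x ∷ xs) K = next (proj-runs i xs K)

mutual
  -- The rest `K` of the stack is arbitrary, so the runs of subprograms compose.
  machine-complete : ∀ {n} {c : PR n} {xs z} → c [ xs ]⇓ z → ∀ K → node (node ⌜ c ⌝ K) ⌜ xs ⌝ᵛ ↝ node K (leaf z)
  machine-complete cz⇓ K = next stop
  machine-complete sc⇓ K = next stop
  machine-complete {xs = xs} (proj⇓ {i = i}) K = proj-runs i xs K
  machine-complete (comp⇓ ds d) K = next (machine-complete* ds (leaf 0) _ ⊙ machine-complete d K)
  machine-complete (prec0 d) K = next (machine-complete d K)
  machine-complete (precS d d′) K = next (machine-complete d _ ⊙ next (machine-complete d′ K))
  machine-complete {xs = xs} (mu⇓ {f = f} {k = k} d ds) K = next (loop k 0 (+-identityʳ k))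
    where
    loop : ∀ m j → m + j ≡ k →
      node (node ⌜ f ⌝ (node (node (leaf 10) (node ⌜ f ⌝ (node (leaf j) ⌜ xs ⌝ᵛ))) K)) (node (leaf j) ⌜ xs ⌝ᵛ)
        ↝ node K (leaf k)
    loop zero j refl = machine-complete d _ ⊙ next stop
    loop (suc m) j e with ds j (subst (suc j ≤_) e (s≤s (m≤n+m j m)))
    ... | v , d′ = machine-complete d′ _ ⊙ next (loop m (suc j) (trans (+-suc m j) e))

  machine-complete* : ∀ {n m} {gs : Vec (PR n) m} {xs ys} → gs [ xs ]⇓* ys → ∀ v K →
    node (node (node (leaf 6) (node ⌜ gs ⌝* ⌜ xs ⌝ᵛ)) K) v ↝ node K ⌜ ys ⌝ᵛ
  machine-complete* []⇓ v K = next stop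
  machine-complete* (∷⇓ d ds) v K =
    next (machine-complete* ds _ _ ⊙ next (machine-complete d _ ⊙ next stop))

data Halts : ℕ → Tree → Set where
  stopped : ∀ {t σ} → isLeaf (car σ) ≡ true → Halts t σ
  stepped : ∀ {t σ} → Halts t (stepᵐ σ) → Halts (suc t) σ

run⇒Halts : ∀ t σ → isLeaf (car (run t σ)) ≡ true → Halts t σ
run⇒Halts zero    σ h = stopped h
run⇒Halts (suc t) σ h = stepped (run⇒Halts t (stepᵐ σ) (subst (λ τ → isLeaf (car τ) ≡ true) (run-suc t σ) h))

proj-sound : ∀ {n} (i : Fin n) xs K {t} → Halts t (node (node (node (leaf 2) ⌜ i ⌝ᶠ) K) ⌜ xs ⌝ᵛ) →
  ∃ λ t′ → t′ < t × Halts t′ (node K (leaf (lookup xs i)))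
proj-sound zero    (x ∷ xs) K (stepped h) = _ , ≤-refl , h
proj-sound (suc i) (x ∷ xs) K (stepped h) with t′ , lt , h′ ← proj-sound i xs K h = t′ , m≤n⇒m≤1+n lt , h′

below-suc : ∀ {P : ℕ → Set} {j} → (∀ i → i < j → P i) → P j → ∀ i → i < suc j → P i
below-suc below p i (s≤s i≤j) with m≤n⇒m<n∨m≡n i≤j
... | inj₁ i<j  = below i i<j
... | inj₂ refl = p

mutual
  -- A halting run must uncover `K` and so pass through a state with stack `K`. What remains has a
  -- smaller step bound, to which the induction applies again; `N` makes this recursion structural.
  machine-sound : ∀ N {t n} (c : PR n) xs K → t ≤ N → Halts t (node (node ⌜ c ⌝ K) ⌜ xs ⌝ᵛ) →
    Σ ℕ λ z → c [ xs ]⇓ z × ∃ λ t′ → t′ < t × Halts t′ (node K (leaf z))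
  machine-sound (suc N) cz xs K le (stepped h) = 0 , cz⇓ , _ , ≤-refl , h
  machine-sound (suc N) sc (x ∷ []) K le (stepped h) = suc x , sc⇓ , _ , ≤-refl , h
  machine-sound N (proj i) xs K le h with t′ , lt , h′ ← proj-sound i xs K h =
    lookup xs i , proj⇓ , t′ , lt , h′
  machine-sound (suc N) (comp f gs) xs K (s≤s le) (stepped h)
    with ys , ds , t₁ , lt₁ , h₁ ← machine-sound* N gs xs (leaf 0) (node ⌜ f ⌝ K) le h
    with z , d , t₂ , lt₂ , h₂ ← machine-sound N f ys K (≤-trans (<⇒≤ lt₁) le) h₁
    = z , comp⇓ ds d , t₂ , m≤n⇒m≤1+n (<-trans lt₂ lt₁) , h₂
  machine-sound (suc N) (prec f g) (zero ∷ xs) K (s≤s le) (stepped h)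
    with z , d , t₁ , lt₁ , h₁ ← machine-sound N f xs K le h
    = z , prec0 d , t₁ , m≤n⇒m≤1+n lt₁ , h₁
  machine-sound (suc N) (prec f g) (suc k ∷ xs) K (s≤s le) (stepped h)
    with machine-sound N (prec f g) (k ∷ xs) _ le h
  ... | z , d , suc t₁ , lt₁ , stepped h₁
    with w , d′ , t₂ , lt₂ , h₂ ← machine-sound N g (k ∷ z ∷ xs) K (≤-trans (<⇒≤ (<-trans ≤-refl lt₁)) le) h₁
    = w , precS d d′ , t₂ , m≤n⇒m≤1+n (<-trans lt₂ (<-trans ≤-refl lt₁)) , h₂
  machine-sound (suc N) (mu f) xs K (s≤s le) (stepped h)
    with k , d , t₁ , lt₁ , h₁ ← μ-sound′ N f xs K 0 (λ _ ()) le h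
    = k , d , t₁ , m≤n⇒m≤1+n lt₁ , h₁

  machine-sound zero cz xs K z≤n (stopped ())
  machine-sound zero sc xs K z≤n (stopped ())
  machine-sound zero (comp f gs) xs K z≤n (stopped ())
  machine-sound zero (prec f g) xs K z≤n (stopped ())
  machine-sound zero (mu f) xs K z≤n (stopped ())

  machine-sound* : ∀ N {t n m} (gs : Vec (PR n) m) xs v K → t ≤ N →
    Halts t (node (node (node (leaf 6) (node ⌜ gs ⌝* ⌜ xs ⌝ᵛ)) K) v) →
    Σ (Vec ℕ m) λ ys → gs [ xs ]⇓* ys × ∃ λ t′ → t′ < t × Halts t′ (node K ⌜ ys ⌝ᵛ)
  machine-sound* N [] xs v K le (stepped h) = [] , []⇓ , _ , ≤-refl , h
  machine-sound* N (g ∷ gs) xs v K le (stepped h)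
    with machine-sound* N gs xs (leaf 0) _ (<⇒≤ le) h
  ... | ys , ds , suc t₁ , lt₁ , stepped h₁
    with machine-sound N g xs _ (<⇒≤ (<-trans (<-trans ≤-refl lt₁) le)) h₁
  ... | z , d , suc t₂ , lt₂ , stepped h₂ =
    z ∷ ys , ∷⇓ d ds , t₂ , m≤n⇒m≤1+n (<-trans ≤-refl (<-trans lt₂ (<-trans ≤-refl lt₁))) , h₂

  μ-sound′ : ∀ N {t n} (f : PR (suc n)) xs K j → (∀ i → i < j → Σ ℕ λ v → f [ i ∷ xs ]⇓ suc v) → t ≤ N →
    Halts t (node (node ⌜ f ⌝ (node (node (leaf 10) (node ⌜ f ⌝ (node (leaf j) ⌜ xs ⌝ᵛ))) K)) (node (leaf j) ⌜ xs ⌝ᵛ)) →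
    Σ ℕ λ k → mu f [ xs ]⇓ k × ∃ λ t′ → t′ < t × Halts t′ (node K (leaf k))
  μ-sound′ N f xs K j below le h with machine-sound N f (j ∷ xs) _ le h
  ... | zero , d , suc t₁ , lt₁ , stepped h₁ = j , mu⇓ d below , t₁ , <-trans ≤-refl lt₁ , h₁
  μ-sound′ (suc N) f xs K j below le h | suc v , d , suc t₁ , lt₁ , stepped h₁
    with k , d′ , t₂ , lt₂ , h₂ ← μ-sound′ N f xs K (suc j) (below-suc below (v , d))
           (≤-pred (≤-trans (<-trans ≤-refl lt₁) le)) h₁
    = k , d′ , t₂ , <-trans lt₂ (<-trans ≤-refl lt₁) , h₂
  μ-sound′ zero f xs K j below z≤n h | suc v , d , suc t₁ , () , stepped h₁

run-stable : ∀ {t t′} σ → t ≤ t′ → isLeaf (car (run t σ)) ≡ true → run t′ σ ≡ run t σ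
run-stable {t} σ p h = iter-fixed stepᵐ σ (≤⇒≤′ p) (stuck (run t σ) h)
  where
  stuck : ∀ τ → isLeaf (car τ) ≡ true → stepᵐ τ ≡ τ
  stuck τ h rewrite h = refl

≡ᵇ-true : ∀ {m n} → (m ≡ᵇ n) ≡ true → m ≡ n
≡ᵇ-true {m} {n} h = ≡ᵇ⇒≡ m n (subst T (sym h) _)

≡ᵇ-refl : ∀ n → (n ≡ᵇ n) ≡ true
≡ᵇ-refl zero    = refl
≡ᵇ-refl (suc n) = ≡ᵇ-refl n

∧-true : ∀ {a b} → (if a then b else false) ≡ true → a ≡ true × b ≡ true
∧-true {true} h = refl , h

true-∧ : ∀ {a b} → a ≡ true → b ≡ true → (if a then b else false) ≡ true
true-∧ refl h = h

-- Clocked halting and output of programs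

start₁ : ℕ → ℕ → Tree
start₁ e x = node (node (toTree e) (leaf 0)) (node (leaf x) (leaf 0))

code : ∀ {n} → PR n → ℕ
code c = encTree ⌜ c ⌝

haltsOn : Tm (nat ∷ tree ∷ tree ∷ []) bool
haltsOn = isLeaf′ (car′ (call run′ (v0 ∷ node′ (node′ v1 nil′) v2 ∷ [])))

opaque
  -- t, r, u, v: does the machine with code r halt on (u, v) within t steps?
  halt′ : Tm (nat ∷ nat ∷ nat ∷ nat ∷ []) bool
  halt′ = call haltsOn (v0 ∷ toTree′ v1 ∷ node′ (leaf′ v2) (node′ (leaf′ v3) nil′) ∷ [])

  -- t, e, x, y: does the machine with code e output y on x within t steps?
  out′ : Tm (nat ∷ nat ∷ nat ∷ nat ∷ []) bool
  out′ = ifb (call haltsOn (v0 ∷ toTree′ v1 ∷ node′ (leaf′ v2) nil′ ∷ []))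
    (eqn (val′ (cdr′ (call run′ (v0 ∷ node′ (node′ (toTree′ v1) nil′) (node′ (leaf′ v2) nil′) ∷ [])))) v3)
    (lit false)

halt out : ℕ → ℕ → ℕ → ℕ → Bool
halt t r u v = ⟦ halt′ ⟧ (t ∷ r ∷ u ∷ v ∷ [])
out t e x y = ⟦ out′ ⟧ (t ∷ e ∷ x ∷ y ∷ [])

opaque
  unfolding halt′

  halt-mono : ∀ {t t′ r u v} → t ≤ t′ → halt t r u v ≡ true → halt t′ r u v ≡ true
  halt-mono p h = trans (cong (isLeaf ∘ car) (run-stable _ p h)) h

  out-mono : ∀ {t t′ e x y} → t ≤ t′ → out t e x y ≡ true → out t′ e x y ≡ true
  out-mono {t} {t′} {e} {x} {y} p h with ∧-true {isLeaf (car (run t (start₁ e x)))} h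
  ... | h₁ , h₂ = true-∧ (trans (cong (isLeaf ∘ car) eq) h₁) (trans (cong (λ σ → val (cdr σ) ≡ᵇ y) eq) h₂)
    where
    eq : run t′ (start₁ e x) ≡ run t (start₁ e x)
    eq = run-stable (start₁ e x) p h₁

  -- With `out-complete` this does the work of soundness: any output reported for the code of a
  -- computable `f` at x equals `f x`.
  out-unique : ∀ {t t′ e x y y′} → out t e x y ≡ true → out t′ e x y′ ≡ true → y ≡ y′
  out-unique {t} {t′} {e} {x} {y} {y′} h h′ = trans
    (sym (value (out-mono {t} {t ⊔ t′} {e} {x} {y} (m≤m⊔n t t′) h)))
    (value (out-mono {t′} {t ⊔ t′} {e} {x} {y′} (m≤n⊔m t t′) h′))
    where
    value : ∀ {w} → out (t ⊔ t′) e x w ≡ true → val (cdr (run (t ⊔ t′) (start₁ e x))) ≡ w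
    value k = ≡ᵇ-true (proj₂ (∧-true {isLeaf (car (run (t ⊔ t′) (start₁ e x)))} k))

  out-complete : ∀ {c : PR 1} {x z} → c [ x ∷ [] ]⇓ z → ∃ λ t → out t (code c) x z ≡ true
  out-complete {c} {x} {z} d with t , h ← ↝⇒run (machine-complete d (leaf 0)) = t , lemma
    where
    h′ : run t (start₁ (code c) x) ≡ node (leaf 0) (leaf z)
    h′ = trans (cong (λ k → run t (node (node k (leaf 0)) (node (leaf x) (leaf 0)))) (toTree-enc ⌜ c ⌝)) h
    lemma : out t (code c) x z ≡ true
    lemma = true-∧ (cong (isLeaf ∘ car) h′) (trans (cong (λ σ → val (cdr σ) ≡ᵇ z) h′) (≡ᵇ-refl z))

  halt-complete : ∀ {c : PR 2} {x y z} → c [ x ∷ y ∷ [] ]⇓ z → ∃ λ t → halt t (code c) x y ≡ true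
  halt-complete {c} {x} {y} {z} d with t , h ← ↝⇒run (machine-complete d (leaf 0)) = t ,
    cong (isLeaf ∘ car)
      (trans (cong (λ k → run t (node (node k (leaf 0)) (node (leaf x) (node (leaf y) (leaf 0))))) (toTree-enc ⌜ c ⌝)) h)

  halt-sound : ∀ {t} {c : PR 2} {x y} → halt t (code c) x y ≡ true → ∃ λ z → c [ x ∷ y ∷ [] ]⇓ z
  halt-sound {t} {c} {x} {y} h with z , d , _ ← machine-sound t c (x ∷ y ∷ []) (leaf 0) ≤-refl
      (run⇒Halts t _ (subst (λ k → isLeaf (car (run t (node (node k (leaf 0)) (node (leaf x) (node (leaf y) (leaf 0)))))) ≡ true)
        (toTree-enc ⌜ c ⌝) h)) = z , d

-- The construction

-- A merge (a , b) redirects the representative a to b, most recent merge first. An entry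
-- (n , i , c) says that c is the current cᵢ of requirement n. The last component of a state
-- lists the requirements that have already merged an output.
Merges Locs : Set
Merges = List (ℕ × ℕ)
Locs   = List (ℕ × ℕ × ℕ)

State : Set
State = Merges × Locs × List ℕ

merges locs : Ty
merges = list (nat ⊗ nat)
locs   = list (nat ⊗ nat ⊗ nat)

state : Ty
state = merges ⊗ locs ⊗ list nat

and′ : ∀ {Γ} → Tm Γ bool → Tm Γ bool → Tm Γ bool
and′ a b = ifb a b (lit false)

not′ : ∀ {Γ} → Tm Γ bool → Tm Γ bool
not′ a = ifb a (lit false) (lit true)

any′ : ∀ {Γ A} → Tm (A ∷ bool ∷ Γ) bool → Tm Γ (list A) → Tm Γ bool
any′ p l = foldr′ l (lit false) (ifb p (lit true) v1)

-- The right fold starts at the oldest merge, so redirections act in the order in which they were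
-- made.
rep′ : Tm (merges ∷ nat ∷ []) nat
rep′ = foldr′ v0 v1 (ifb (eqn v1 (fst′ v0)) (snd′ v0) v1)

mem′ : Tm (nat ∷ list nat ∷ []) bool
mem′ = any′ (eqn v0 v2) v1

loc′ : Tm (nat ∷ nat ∷ nat ∷ locs ∷ []) bool
loc′ = any′ (and′ (eqn (fst′ v0) v2) (and′ (eqn (fst′ (snd′ v0)) v3) (eqn (snd′ (snd′ v0)) v4))) v3

has′ : Tm (nat ∷ nat ∷ locs ∷ []) bool
has′ = any′ (and′ (eqn (fst′ v0) v2) (eqn (fst′ (snd′ v0)) v3)) v2

hits′ : Tm (merges ∷ locs ∷ nat ∷ nat ∷ []) bool
hits′ = any′ (and′ (leqn (fst′ v0) v4)
  (eqn (call rep′ (v2 ∷ snd′ (snd′ v0) ∷ [])) (call rep′ (v2 ∷ v5 ∷ [])))) v1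

below′ : Tm (nat ∷ locs ∷ []) locs
below′ = foldr′ v1 (lit []) (ifb (leqn (fst′ v0) v2) (cons v0 v1) v1)

rep : Merges → ℕ → ℕ
rep M z = ⟦ rep′ ⟧ (M ∷ z ∷ [])

mem : ℕ → List ℕ → Bool
mem n D = ⟦ mem′ ⟧ (n ∷ D ∷ [])

isLoc : ℕ → ℕ → ℕ → Locs → Bool
isLoc n i c A = ⟦ loc′ ⟧ (n ∷ i ∷ c ∷ A ∷ [])

has : ℕ → ℕ → Locs → Bool
has n i A = ⟦ has′ ⟧ (n ∷ i ∷ A ∷ [])

hits : Merges → Locs → ℕ → ℕ → Bool
hits M A n y = ⟦ hits′ ⟧ (M ∷ A ∷ n ∷ y ∷ [])

below : ℕ → Locs → Locs
below n A = ⟦ below′ ⟧ (n ∷ A ∷ [])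

anyᵇ : ∀ {X : Set} → (X → Bool) → List X → Bool
anyᵇ p = foldr (λ x b → if p x then true else b) false

anyᵇ-∈ : ∀ {X : Set} (p : X → Bool) xs → anyᵇ p xs ≡ true → Σ X λ x → x ∈ xs × p x ≡ true
anyᵇ-∈ p (x ∷ xs) h with p x in eq
... | true = x , here refl , eq
... | false with y , y∈ , py ← anyᵇ-∈ p xs h = y , there y∈ , py

∈-anyᵇ : ∀ {X : Set} (p : X → Bool) {x xs} → x ∈ xs → p x ≡ true → anyᵇ p xs ≡ true
∈-anyᵇ p (here refl) h rewrite h = refl
∈-anyᵇ p {xs = y ∷ ys} (there x∈) h with p y
... | true  = refl
... | false = ∈-anyᵇ p x∈ h

mem-∈ : ∀ {n} D → mem n D ≡ true → n ∈ D
mem-∈ {n} D h with x , x∈ , e ← anyᵇ-∈ (λ x → x ≡ᵇ n) D h = subst (_∈ D) (≡ᵇ-true e) x∈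

∈-mem : ∀ {n D} → n ∈ D → mem n D ≡ true
∈-mem {n} n∈ = ∈-anyᵇ (λ x → x ≡ᵇ n) n∈ (≡ᵇ-refl n)

isLoc-∈ : ∀ {n i c} A → isLoc n i c A ≡ true → (n , i , c) ∈ A
isLoc-∈ {n} {i} {c} A h with (n′ , i′ , c′) , x∈ , e ← anyᵇ-∈ _ A h
  with e₁ , e₂₃ ← ∧-true {n′ ≡ᵇ n} e
  with e₂ , e₃ ← ∧-true {i′ ≡ᵇ i} e₂₃
  with refl ← ≡ᵇ-true {n′} e₁ | refl ← ≡ᵇ-true {i′} e₂ | refl ← ≡ᵇ-true {c′} e₃ = x∈

∈-isLoc : ∀ {n i c A} → (n , i , c) ∈ A → isLoc n i c A ≡ true
∈-isLoc {n} {i} {c} x∈ = ∈-anyᵇ _ x∈ (true-∧ (≡ᵇ-refl n) (true-∧ (≡ᵇ-refl i) (≡ᵇ-refl c)))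

has-∈ : ∀ {n i} A → has n i A ≡ true → ∃ λ c → (n , i , c) ∈ A
has-∈ {n} {i} A h with (n′ , i′ , c′) , x∈ , e ← anyᵇ-∈ _ A h
  with e₁ , e₂ ← ∧-true {n′ ≡ᵇ n} e
  with refl ← ≡ᵇ-true {n′} e₁ | refl ← ≡ᵇ-true {i′} e₂ = c′ , x∈

∈-has : ∀ {n i c A} → (n , i , c) ∈ A → has n i A ≡ true
∈-has {n} {i} x∈ = ∈-anyᵇ _ x∈ (true-∧ (≡ᵇ-refl n) (≡ᵇ-refl i))

≤ᵇ-true : ∀ {m n} → (m ≤ᵇ n) ≡ true → m ≤ n
≤ᵇ-true {m} {n} h = ≤ᵇ⇒≤ m n (subst T (sym h) _)

true-≤ᵇ : ∀ {m n} → m ≤ n → (m ≤ᵇ n) ≡ true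
true-≤ᵇ {m} {n} p with m ≤ᵇ n | ≤⇒≤ᵇ p
... | true | _ = refl

≢true : ∀ {b} → b ≢ true → b ≡ false
≢true {true}  h = contradiction refl h
≢true {false} h = refl

false≢true : ∀ {b} → b ≡ false → b ≢ true
false≢true refl ()

Unprotected : Merges → Locs → ℕ → ℕ → Set
Unprotected M A n y = ∀ {n′ i c} → (n′ , i , c) ∈ A → n′ ≤ n → rep M c ≢ rep M y

hits-false : ∀ {M A n y} → hits M A n y ≡ false → Unprotected M A n y
hits-false {M} {A} {n} {y} h a∈ n′≤n e = false≢true h (∈-anyᵇ _ a∈ (true-∧ (true-≤ᵇ n′≤n)
  (trans (cong (_≡ᵇ rep M y) e) (≡ᵇ-refl (rep M y)))))

false-hits : ∀ {M A n y} → Unprotected M A n y → hits M A n y ≡ false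
false-hits {M} {A} {n} {y} u = ≢true λ h → case anyᵇ-∈ _ A h of λ
  ((n′ , i , c) , a∈ , e) → case ∧-true {n′ ≤ᵇ n} e of λ
  (e₁ , e₂) → u a∈ (≤ᵇ-true e₁) (≡ᵇ-true e₂)

below-∈ : ∀ {n a} A → a ∈ below n A → a ∈ A × proj₁ a ≤ n
below-∈ {n} (b ∷ A) a∈ with proj₁ b ≤ᵇ n in eq
below-∈ {n} (b ∷ A) (here refl) | true = here refl , ≤ᵇ-true eq
below-∈ {n} (b ∷ A) (there a∈) | true with p , q ← below-∈ A a∈ = there p , q
below-∈ {n} (b ∷ A) a∈ | false with p , q ← below-∈ A a∈ = there p , q

∈-below : ∀ {n a A} → a ∈ A → proj₁ a ≤ n → a ∈ below n A
∈-below {n} {a} (here refl) p rewrite true-≤ᵇ p = here refl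
∈-below {n} {a} {b ∷ A} (there a∈) p with proj₁ b ≤ᵇ n
... | true  = there (∈-below a∈ p)
... | false = ∈-below a∈ p

rep-hit : ∀ {a b} M z → rep M z ≡ a → rep ((a , b) ∷ M) z ≡ b
rep-hit M z refl rewrite ≡ᵇ-refl (rep M z) = refl

rep-miss : ∀ {a b} M z → rep M z ≢ a → rep ((a , b) ∷ M) z ≡ rep M z
rep-miss {a} M z h with rep M z ≡ᵇ a in eq
... | true  = contradiction (≡ᵇ-true eq) h
... | false = refl

rep-cong : ∀ m M {z w} → rep M z ≡ rep M w → rep (m ∷ M) z ≡ rep (m ∷ M) w
rep-cong (a , b) M e = cong (λ r → if r ≡ᵇ a then b else r) e

-- Has the shape of the last conjunct of `agreeing′`, so the two agree by computation.
eqb : Bool → Bool → Bool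
eqb a b = if a then b else (if b then false else true)

eqb-true : ∀ {a b} → eqb a b ≡ true → a ≡ b
eqb-true {true}  {true}  h = refl
eqb-true {false} {false} h = refl

true-eqb : ∀ {a b} → a ≡ b → eqb a b ≡ true
true-eqb {true}  refl = refl
true-eqb {false} refl = refl

Dom : ℕ → BinRel
Dom r u v = ∃ λ t → halt t r u v ≡ true

module Construction (Ks : List ℕ) where

  mergeAct′ : Tm (nat ∷ nat ∷ nat ∷ nat ∷ state ∷ []) state
  mergeAct′ = ifb (and′ (call out′ (v3 ∷ π₁′ v0 ∷ v1 ∷ v2 ∷ []))
                  (and′ (not′ (call mem′ (v0 ∷ D ∷ [])))
                        (not′ (call hits′ (M ∷ A ∷ v0 ∷ v2 ∷ [])))))
    -- The class of the output is redirected to that of `π₂ n`, not conversely: the latter may be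
    -- protected and keeps its representative. `n` stays recorded as done even if its locations are
    -- erased later, since the merge cannot be undone.
    (pair (cons (pair (call rep′ (M ∷ v2 ∷ [])) (call rep′ (M ∷ π₂′ v0 ∷ []))) M)
          (pair (call below′ (v0 ∷ A ∷ [])) (cons v0 D)))
    v4
    where
    M : Tm (nat ∷ nat ∷ nat ∷ nat ∷ state ∷ []) merges
    M = fst′ v4
    A : Tm (nat ∷ nat ∷ nat ∷ nat ∷ state ∷ []) locs
    A = fst′ (snd′ v4)
    D : Tm (nat ∷ nat ∷ nat ∷ nat ∷ state ∷ []) (list nat)
    D = snd′ (snd′ v4)

  mergeAct : ℕ → ℕ → ℕ → ℕ → State → State
  mergeAct n x y t σ = ⟦ mergeAct′ ⟧ (n ∷ x ∷ y ∷ t ∷ σ ∷ [])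

  -- Without a protection test: a class with a location of `n` contains locations of no other
  -- requirement, so coding injures nobody and leaves the locations as they are.
  copyAct′ : Tm (nat ∷ nat ∷ nat ∷ nat ∷ nat ∷ nat ∷ state ∷ []) state
  copyAct′ = ifb (and′ (call loc′ (v0 ∷ v1 ∷ v2 ∷ A ∷ []))
                 (and′ (call loc′ (v0 ∷ v3 ∷ v4 ∷ A ∷ []))
                 (and′ (call mem′ (π₂′ v0 ∷ lit Ks ∷ []))
                       (call halt′ (v5 ∷ π₂′ (π₂′ v0) ∷ v1 ∷ v3 ∷ [])))))
    (pair (cons (pair (call rep′ (fst′ v6 ∷ v2 ∷ [])) (call rep′ (fst′ v6 ∷ v4 ∷ []))) (fst′ v6)) (snd′ v6))
    v6
    where
    A : Tm (nat ∷ nat ∷ nat ∷ nat ∷ nat ∷ nat ∷ state ∷ []) locs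
    A = fst′ (snd′ v6)

  copyAct : ℕ → ℕ → ℕ → ℕ → ℕ → ℕ → State → State
  copyAct n i c j c′ t σ = ⟦ copyAct′ ⟧ (n ∷ i ∷ c ∷ j ∷ c′ ∷ t ∷ σ ∷ [])

  alloc′ : Tm (nat ∷ nat ∷ nat ∷ state ∷ []) state
  alloc′ = ifb (call has′ (v1 ∷ v2 ∷ fst′ (snd′ v3) ∷ [])) v3
    (pair (fst′ v3) (pair (cons (pair v1 (pair v2 v0)) (fst′ (snd′ v3))) (snd′ (snd′ v3))))

  alloc : ℕ → ℕ → ℕ → State → State
  alloc s n L σ = ⟦ alloc′ ⟧ (s ∷ n ∷ L ∷ σ ∷ [])

  agreeing′ : Tm (nat ∷ nat ∷ nat ∷ nat ∷ nat ∷ nat ∷ nat ∷ state ∷ []) bool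
  agreeing′ =
    and′ (call mem′ (π₂′ v0 ∷ lit Ks ∷ [])) $
    and′ (call has′ (v0 ∷ v1 ∷ A ∷ [])) $
    and′ (call loc′ (v0 ∷ π₁′ (π₁′ v1) ∷ v3 ∷ A ∷ [])) $
    and′ (call loc′ (v0 ∷ π₂′ (π₁′ v1) ∷ v5 ∷ A ∷ [])) $
    and′ (call out′ (v2 ∷ π₁′ v0 ∷ v3 ∷ v4 ∷ [])) $
    and′ (call out′ (v2 ∷ π₁′ v0 ∷ v5 ∷ v6 ∷ [])) $
    -- The clock has to grow with the list; otherwise a relation that shows up late in the target
    -- could be overlooked forever.
    and′ (leqn v1 v2) $
    ifb (eqn (call rep′ (M ∷ v3 ∷ [])) (call rep′ (M ∷ v5 ∷ []))) R (not′ R)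
    where
    M : Tm (nat ∷ nat ∷ nat ∷ nat ∷ nat ∷ nat ∷ nat ∷ state ∷ []) merges
    M = fst′ (var (there (there (there (there (there (there (there here))))))))
    A : Tm (nat ∷ nat ∷ nat ∷ nat ∷ nat ∷ nat ∷ nat ∷ state ∷ []) locs
    A = fst′ (snd′ (var (there (there (there (there (there (there (there here)))))))))
    R : Tm (nat ∷ nat ∷ nat ∷ nat ∷ nat ∷ nat ∷ nat ∷ state ∷ []) bool
    R = call halt′ (v2 ∷ π₁′ (π₂′ v0) ∷ v4 ∷ v6 ∷ [])

  agreeing : ℕ → ℕ → ℕ → ℕ → ℕ → ℕ → ℕ → State → Bool
  agreeing n L t c u c′ v σ = ⟦ agreeing′ ⟧ (n ∷ L ∷ t ∷ c ∷ u ∷ c′ ∷ v ∷ σ ∷ [])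

  -- The stage number ⟨tag , ⟨n , q⟩⟩ itself proposes the action to be tried, including all
  -- witnesses and the time bound, so no search happens within a stage.
  step′ : Tm (nat ∷ state ∷ []) state
  step′ =
    ifb (eqn tag (lit 0)) (call mergeAct′ (n ∷ π₁′ q ∷ π₁′ (π₂′ q) ∷ π₂′ (π₂′ q) ∷ v1 ∷ [])) $
    ifb (eqn tag (lit 1)) (call copyAct′ (n ∷ π₁′ (π₁′ q) ∷ π₂′ (π₁′ q) ∷
      π₁′ (π₁′ (π₂′ q)) ∷ π₂′ (π₁′ (π₂′ q)) ∷ π₂′ (π₂′ q) ∷ v1 ∷ [])) $
    ifb (eqn tag (lit 2)) (call alloc′ (v0 ∷ n ∷ lit 0 ∷ v1 ∷ [])) $
    ifb (call agreeing′ (n ∷ π₁′ q ∷ π₁′ (π₂′ q) ∷ π₁′ (π₁′ (π₂′ (π₂′ q))) ∷ π₂′ (π₁′ (π₂′ (π₂′ q))) ∷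
      π₁′ (π₂′ (π₂′ (π₂′ q))) ∷ π₂′ (π₂′ (π₂′ (π₂′ q))) ∷ v1 ∷ []))
      (call alloc′ (v0 ∷ n ∷ suc′ (π₁′ q) ∷ v1 ∷ [])) v1
    where
    tag n q : Tm (nat ∷ state ∷ []) nat
    tag = π₁′ v0
    n = π₁′ (π₂′ v0)
    q = π₂′ (π₂′ v0)

  -- For n = ⟨e , k⟩ with k = ⟨r , x⟩, the coding part of requirement n codes Dom x against
  -- reductions to Dom r; it is active only if k ∈ Ks. At length L it compares the pair of
  -- indices π₁ L, so that every pair is compared infinitely often. New locations are
  -- stage numbers, hence larger than every number mentioned before.
  data Act (s : ℕ) (M : Merges) (A : Locs) (D : List ℕ) : State → Set where
    idle   : Act s M A D (M , A , D)
    merge  : ∀ n x y t → n ≤ s → y ≤ s → out t (π₁ n) x y ≡ true → n ∉ D → Unprotected M A n y →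
             Act s M A D ((rep M y , rep M (π₂ n)) ∷ M , below n A , n ∷ D)
    copy   : ∀ n i c j c′ t → (n , i , c) ∈ A → (n , j , c′) ∈ A → π₂ n ∈ Ks → halt t (π₂ (π₂ n)) i j ≡ true →
             Act s M A D ((rep M c , rep M c′) ∷ M , A , D)
    start  : ∀ n → has n 0 A ≡ false → Act s M A D (M , (n , 0 , s) ∷ A , D)
    extend : ∀ n L t c u c′ v → L ≤ s → π₂ n ∈ Ks → has n L A ≡ true → has n (suc L) A ≡ false →
             (n , π₁ (π₁ L) , c) ∈ A → (n , π₂ (π₁ L) , c′) ∈ A →
             out t (π₁ n) c u ≡ true → out t (π₁ n) c′ v ≡ true → L ≤ t →
             (rep M c ≡ᵇ rep M c′) ≡ halt t (π₁ (π₂ n)) u v →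
             Act s M A D (M , (n , suc L , s) ∷ A , D)

  mergeAct-Act : ∀ {s} n x y t M A D → n ≤ s → y ≤ s → Act s M A D (mergeAct n x y t (M , A , D))
  mergeAct-Act n x y t M A D n≤s y≤s
    with out t (π₁ n) x y in eq₁ | mem n D in eq₂ | hits M A n y in eq₃
  ... | false | _     | _     = idle
  ... | true  | true  | _     = idle
  ... | true  | false | true  = idle
  ... | true  | false | false =
    merge n x y t n≤s y≤s eq₁ (λ n∈ → false≢true eq₂ (∈-mem n∈)) (hits-false {M} {A} {n} {y} eq₃)

  copyAct-Act : ∀ {s} n i c j c′ t M A D → Act s M A D (copyAct n i c j c′ t (M , A , D))
  copyAct-Act n i c j c′ t M A D
    with isLoc n i c A in eq₁ | isLoc n j c′ A in eq₂ | mem (π₂ n) Ks in eq₃ | halt t (π₂ (π₂ n)) i j in eq₄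
  ... | false | _     | _     | _     = idle
  ... | true  | false | _     | _     = idle
  ... | true  | true  | false | _     = idle
  ... | true  | true  | true  | false = idle
  ... | true  | true  | true  | true  = copy n i c j c′ t (isLoc-∈ A eq₁) (isLoc-∈ A eq₂) (mem-∈ Ks eq₃) eq₄

  start-Act : ∀ s n M A D → Act s M A D (alloc s n 0 (M , A , D))
  start-Act s n M A D with has n 0 A in eq
  ... | true  = idle
  ... | false = start n eq

  extend-Act : ∀ s n L t c u c′ v M A D → L ≤ s → agreeing n L t c u c′ v (M , A , D) ≡ true →
    Act s M A D (alloc s n (suc L) (M , A , D))
  extend-Act s n L t c u c′ v M A D L≤s h with has n (suc L) A in eq
  ... | true  = idle
  ... | false
    with h₁ , h ← ∧-true {mem (π₂ n) Ks} h
    with h₂ , h ← ∧-true {has n L A} h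
    with h₃ , h ← ∧-true {isLoc n (π₁ (π₁ L)) c A} h
    with h₄ , h ← ∧-true {isLoc n (π₂ (π₁ L)) c′ A} h
    with h₅ , h ← ∧-true {out t (π₁ n) c u} h
    with h₆ , h ← ∧-true {out t (π₁ n) c′ v} h
    with h₇ , h ← ∧-true {L ≤ᵇ t} h
    = extend n L t c u c′ v L≤s (mem-∈ Ks h₁) h₂ eq (isLoc-∈ A h₃) (isLoc-∈ A h₄) h₅ h₆ (≤ᵇ-true h₇) (eqb-true h)

  if-extend-Act : ∀ s n L t c u c′ v M A D → L ≤ s → Act s M A D
    (if agreeing n L t c u c′ v (M , A , D) then alloc s n (suc L) (M , A , D) else (M , A , D))
  if-extend-Act s n L t c u c′ v M A D L≤s with agreeing n L t c u c′ v (M , A , D) in eq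
  ... | true  = extend-Act s n L t c u c′ v M A D L≤s eq
  ... | false = idle

  true-agreeing : ∀ n L t c u c′ v M A D → π₂ n ∈ Ks → has n L A ≡ true →
    (n , π₁ (π₁ L) , c) ∈ A → (n , π₂ (π₁ L) , c′) ∈ A →
    out t (π₁ n) c u ≡ true → out t (π₁ n) c′ v ≡ true → L ≤ t →
    (rep M c ≡ᵇ rep M c′) ≡ halt t (π₁ (π₂ n)) u v → agreeing n L t c u c′ v (M , A , D) ≡ true
  true-agreeing n L t c u c′ v M A D h₁ h₂ h₃ h₄ h₅ h₆ h₇ h₈ =
    true-∧ (∈-mem h₁) (true-∧ h₂ (true-∧ (∈-isLoc h₃) (true-∧ (∈-isLoc h₄)
      (true-∧ h₅ (true-∧ h₆ (true-∧ (true-≤ᵇ h₇) (true-eqb h₈)))))))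

  opaque
    step : ℕ → State → State
    step s σ = ⟦ step′ ⟧ (s ∷ σ ∷ [])

    step-Act : ∀ s M A D → Act s M A D (step s (M , A , D))
    step-Act s M A D with π₁ s ≡ᵇ 0 | π₁ s ≡ᵇ 1 | π₁ s ≡ᵇ 2
    ... | true  | _     | _     = mergeAct-Act _ _ _ _ M A D
        (≤-trans (π₁≤ _) (π₂≤ s)) (≤-trans (π₁≤ _) (≤-trans (π₂≤ _) (≤-trans (π₂≤ _) (π₂≤ s))))
    ... | false | true  | _     = copyAct-Act _ _ _ _ _ _ M A D
    ... | false | false | true  = start-Act s _ M A D
    ... | false | false | false = if-extend-Act s _ _ _ _ _ _ _ M A D (≤-trans (π₁≤ _) (≤-trans (π₂≤ _) (π₂≤ s)))

    step-merge : ∀ n x y t σ → step (π 0 (π n (π x (π y t)))) σ ≡ mergeAct n x y t σ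
    step-merge n x y t σ
      rewrite π₁-π 0 (π n (π x (π y t))) | π₂-π 0 (π n (π x (π y t))) | π₁-π n (π x (π y t))
            | π₂-π n (π x (π y t)) | π₁-π x (π y t) | π₂-π x (π y t) | π₁-π y t | π₂-π y t = refl

    step-copy : ∀ n i c j c′ t σ →
      step (π 1 (π n (π (π i c) (π (π j c′) t)))) σ ≡ copyAct n i c j c′ t σ
    step-copy n i c j c′ t σ
      rewrite π₁-π 1 (π n (π (π i c) (π (π j c′) t))) | π₂-π 1 (π n (π (π i c) (π (π j c′) t)))
            | π₁-π n (π (π i c) (π (π j c′) t)) | π₂-π n (π (π i c) (π (π j c′) t))
            | π₁-π (π i c) (π (π j c′) t) | π₂-π (π i c) (π (π j c′) t) | π₁-π i c | π₂-π i c
            | π₁-π (π j c′) t | π₂-π (π j c′) t | π₁-π j c′ | π₂-π j c′ = refl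

    step-start : ∀ n q σ → step (π 2 (π n q)) σ ≡ alloc (π 2 (π n q)) n 0 σ
    step-start n q σ
      rewrite π₁-π 2 (π n q) | π₂-π 2 (π n q) | π₁-π n q = refl

    step-extend : ∀ n L t c u c′ v σ → agreeing n L t c u c′ v σ ≡ true →
      step (π 3 (π n (π L (π t (π (π c u) (π c′ v)))))) σ ≡
      alloc (π 3 (π n (π L (π t (π (π c u) (π c′ v)))))) n (suc L) σ
    step-extend n L t c u c′ v σ h
      rewrite π₁-π 3 (π n (π L (π t (π (π c u) (π c′ v))))) | π₂-π 3 (π n (π L (π t (π (π c u) (π c′ v)))))
            | π₁-π n (π L (π t (π (π c u) (π c′ v)))) | π₂-π n (π L (π t (π (π c u) (π c′ v))))
            | π₁-π L (π t (π (π c u) (π c′ v))) | π₂-π L (π t (π (π c u) (π c′ v)))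
            | π₁-π t (π (π c u) (π c′ v)) | π₂-π t (π (π c u) (π c′ v))
            | π₁-π (π c u) (π c′ v) | π₂-π (π c u) (π c′ v) | π₁-π c u | π₂-π c u | π₁-π c′ v | π₂-π c′ v
            | h = refl

  stage : ℕ → State
  stage = natrec ([] , [] , []) step

  Mˢ : ℕ → Merges
  Mˢ s = proj₁ (stage s)

  Aˢ : ℕ → Locs
  Aˢ s = proj₁ (proj₂ (stage s))

  Dˢ : ℕ → List ℕ
  Dˢ s = proj₂ (proj₂ (stage s))

  opaque
    unfolding step

    stage′ : Tm (nat ∷ []) state
    stage′ = natrec′ v0 (lit ([] , [] , [])) (call step′ (v0 ∷ v1 ∷ []))

    stage-eval : ∀ s → ⟦ stage′ ⟧ (s ∷ []) ≡ stage s
    stage-eval s = refl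

  stage-Act : ∀ s → Act s (Mˢ s) (Aˢ s) (Dˢ s) (stage (suc s))
  stage-Act s = step-Act s (Mˢ s) (Aˢ s) (Dˢ s)

  E : BinRel
  E x y = ∃ λ s → rep (Mˢ s) x ≡ rep (Mˢ s) y

  Act-rep : ∀ {s M A D σ} → Act s M A D σ → ∀ {z w} → rep M z ≡ rep M w → rep (proj₁ σ) z ≡ rep (proj₁ σ) w
  Act-rep idle e = e
  Act-rep {M = M} (merge _ _ _ _ _ _ _ _ _) e = rep-cong _ M e
  Act-rep {M = M} (copy _ _ _ _ _ _ _ _ _ _) e = rep-cong _ M e
  Act-rep (start _ _) e = e
  Act-rep (extend _ _ _ _ _ _ _ _ _ _ _ _ _ _ _ _ _) e = e

  rep-mono : ∀ {s s′ z w} → s ≤ s′ → rep (Mˢ s) z ≡ rep (Mˢ s) w → rep (Mˢ s′) z ≡ rep (Mˢ s′) w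
  rep-mono {s} {z = z} {w} p e = go (≤⇒≤′ p)
    where
    go : ∀ {s′} → s ≤′ s′ → rep (Mˢ s′) z ≡ rep (Mˢ s′) w
    go ≤′-refl = e
    go (≤′-step q) = Act-rep (stage-Act _) (go q)

  E-isEquivalence : IsEquivalence E
  E-isEquivalence = record
    { refl  = 0 , refl
    ; sym   = λ (s , e) → s , sym e
    ; trans = λ (s , e) (s′ , e′) → s ⊔ s′ ,
        trans (rep-mono (m≤m⊔n s s′) e) (rep-mono (m≤n⊔m s s′) e′)
    }

  related′ : Tm (nat ∷ nat ∷ nat ∷ []) bool
  related′ = eqn (call rep′ (fst′ (call stage′ (v0 ∷ [])) ∷ v1 ∷ []))
                 (call rep′ (fst′ (call stage′ (v0 ∷ [])) ∷ v2 ∷ []))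

  related-eval : ∀ s x y → ⟦ related′ ⟧ (s ∷ x ∷ y ∷ []) ≡ (rep (Mˢ s) x ≡ᵇ rep (Mˢ s) y)
  related-eval s x y rewrite stage-eval s = refl

  true-≡ᵇ : ∀ {m n} → m ≡ n → (m ≡ᵇ n) ≡ true
  true-≡ᵇ {m} refl = ≡ᵇ-refl m

  opaque
    E-CE : CE E
    E-CE with c , h ← ∃-CE related′ = c , λ x y →
      (λ (s , e) → proj₁ (h x y) (s , trans (related-eval s x y) (true-≡ᵇ e))) ,
      (λ d → let s , e = proj₂ (h x y) d in s , ≡ᵇ-true (trans (sym (related-eval s x y)) e))

  Act-done : ∀ {s M A D σ} → Act s M A D σ → ∀ {n} → n ∈ D → n ∈ proj₂ (proj₂ σ)
  Act-done idle n∈ = n∈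
  Act-done (merge _ _ _ _ _ _ _ _ _) n∈ = there n∈
  Act-done (copy _ _ _ _ _ _ _ _ _ _) n∈ = n∈
  Act-done (start _ _) n∈ = n∈
  Act-done (extend _ _ _ _ _ _ _ _ _ _ _ _ _ _ _ _ _) n∈ = n∈

  done-mono : ∀ {s s′ n} → s ≤ s′ → n ∈ Dˢ s → n ∈ Dˢ s′
  done-mono {s} {n = n} p n∈ = go (≤⇒≤′ p)
    where
    go : ∀ {s′} → s ≤′ s′ → n ∈ Dˢ s′
    go ≤′-refl = n∈
    go (≤′-step q) = Act-done (stage-Act _) (go q)

  -- A merge by m erases only locations of requirements above m and newly records m as done; if
  -- nothing below N is newly recorded, the locations up to N survive.
  Act-persist : ∀ {s M A D σ N} → Act s M A D σ → (∀ m → m < N → m ∈ proj₂ (proj₂ σ) → m ∈ D) →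
    ∀ {n i c} → n ≤ N → (n , i , c) ∈ A → (n , i , c) ∈ proj₁ (proj₂ σ)
  Act-persist idle _ _ a∈ = a∈
  Act-persist {N = N} (merge m _ _ _ _ _ _ m∉ _) quiet n≤N a∈ with m <? N
  ... | yes m<N = contradiction (quiet m m<N (here refl)) m∉
  ... | no  m≮N = ∈-below a∈ (≤-trans n≤N (≮⇒≥ m≮N))
  Act-persist (copy _ _ _ _ _ _ _ _ _ _) _ _ a∈ = a∈
  Act-persist (start _ _) _ _ a∈ = there a∈
  Act-persist (extend _ _ _ _ _ _ _ _ _ _ _ _ _ _ _ _ _) _ _ a∈ = there a∈

  -- The disjunct `i ≡ j` serves requirements with `π₂ n` outside `Ks`, where the domain need not be
  -- reflexive.
  Same : ℕ → ℕ → ℕ → Set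
  Same n i j = i ≡ j ⊎ (π₂ n ∈ Ks × Dom (π₂ (π₂ n)) i j)

  record Agreement (n L : ℕ) (A : Locs) : Set where
    field
      k∈ : π₂ n ∈ Ks
      {c c′ u v t s} : ℕ
      c∈  : (n , π₁ (π₁ L) , c) ∈ A
      c′∈ : (n , π₂ (π₁ L) , c′) ∈ A
      φc  : out t (π₁ n) c u ≡ true
      φc′ : out t (π₁ n) c′ v ≡ true
      L≤t : L ≤ t
      L≤s : L ≤ s
      agree : (rep (Mˢ s) c ≡ᵇ rep (Mˢ s) c′) ≡ halt t (π₁ (π₂ n)) u v

  agreement-map : ∀ {n L A A′} → (∀ {i c} → (n , i , c) ∈ A → (n , i , c) ∈ A′) → Agreement n L A → Agreement n L A′
  agreement-map f a = record
    { Agreement a hiding (c∈ ; c′∈) ; c∈ = f (Agreement.c∈ a) ; c′∈ = f (Agreement.c′∈ a) }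

  -- `rep-<` and `rep-≥` make the stage number `s` a class of its own, fit to be a new location.
  -- `sep` is the heart: it later yields both the correctness of the coding and the infinitely many
  -- classes.
  record Inv (s : ℕ) (M : Merges) (A : Locs) (D : List ℕ) : Set where
    field
      rep-<  : ∀ z → z < s → rep M z < s
      rep-≥  : ∀ z → s ≤ z → rep M z ≡ z
      loc-<  : ∀ {n i c} → (n , i , c) ∈ A → c < s
      sep    : ∀ {n i c n′ i′ c′} → (n , i , c) ∈ A → (n′ , i′ , c′) ∈ A → rep M c ≡ rep M c′ → n ≡ n′ × Same n i i′
      uniq   : ∀ {n i c c′} → (n , i , c) ∈ A → (n , i , c′) ∈ A → c ≡ c′
      down   : ∀ {n i c} → (n , suc i , c) ∈ A → ∃ λ c′ → (n , i , c′) ∈ A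
      done   : ∀ {n} → n ∈ D → ∃ λ x → ∃ λ y → ∃ λ t → out t (π₁ n) x y ≡ true × rep M y ≡ rep M (π₂ n)
      agreed : ∀ {n L c} → (n , suc L , c) ∈ A → Agreement n L A

  rep-≤ : ∀ {s M A D} → Inv s M A D → ∀ {z} → z ≤ s → rep M z ≤ s
  rep-≤ I {z} z≤s with m≤n⇒m<n∨m≡n z≤s
  ... | inj₁ lt  = <⇒≤ (Inv.rep-< I z lt)
  ... | inj₂ refl = ≤-reflexive (Inv.rep-≥ I z ≤-refl)

  module Merging {s M A D} (I : Inv s M A D) {a b : ℕ} (a≤s : a ≤ s) (b≤s : b ≤ s) where
    open Inv I

    rep-<′ : ∀ z → z < suc s → rep ((a , b) ∷ M) z < suc s
    rep-<′ z (s≤s z≤s) with rep M z ≟ a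
    ... | yes e = subst (_< suc s) (sym (rep-hit M z e)) (s≤s b≤s)
    ... | no ne = subst (_< suc s) (sym (rep-miss M z ne)) (s≤s (rep-≤ I z≤s))

    rep-≥′ : ∀ z → suc s ≤ z → rep ((a , b) ∷ M) z ≡ z
    rep-≥′ z s<z = trans (rep-miss M z ne) eq
      where
      eq : rep M z ≡ z
      eq = rep-≥ z (<⇒≤ s<z)
      ne : rep M z ≢ a
      ne e = <⇒≱ s<z (subst (_≤ s) (trans (sym e) eq) a≤s)

  module WithEquivalences (Dom-isEquivalence : ∀ k → k ∈ Ks → IsEquivalence (Dom (π₂ k))) where

    Same-sym : ∀ {n i j} → Same n i j → Same n j i
    Same-sym (inj₁ e) = inj₁ (sym e)
    Same-sym {n} (inj₂ (k∈ , x)) = inj₂ (k∈ , IsEquivalence.sym (Dom-isEquivalence (π₂ n) k∈) x)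

    Same-trans : ∀ {n i j k} → Same n i j → Same n j k → Same n i k
    Same-trans (inj₁ refl) q = q
    Same-trans (inj₂ p) (inj₁ refl) = inj₂ p
    Same-trans {n} (inj₂ (k∈ , x)) (inj₂ (_ , y)) = inj₂ (k∈ , IsEquivalence.trans (Dom-isEquivalence (π₂ n) k∈) x y)

    Inv-alloc : ∀ {s M A D} → Inv s M A D → ∀ n L → has n L A ≡ false →
      (∀ {i} → L ≡ suc i → has n i A ≡ true) → (∀ {i} → L ≡ suc i → Agreement n i A) →
      Inv (suc s) M ((n , L , s) ∷ A) D
    Inv-alloc {s} {M} {A} {D} I n L new prev agr = record
      { rep-<  = λ { z (s≤s z≤s) → s≤s (rep-≤ I z≤s) }
      ; rep-≥  = λ z s<z → rep-≥ z (<⇒≤ s<z)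
      ; loc-<  = λ { (here refl) → ≤-refl ; (there a∈) → m<n⇒m<1+n (loc-< a∈) }
      ; sep    = sep′
      ; uniq   = uniq′
      ; down   = down′
      ; done   = done
      ; agreed = λ { (here refl) → agreement-map there (agr refl) ; (there a∈) → agreement-map there (agreed a∈) }
      }
      where
      open Inv I
      fresh : ∀ {n i c} → (n , i , c) ∈ A → rep M c ≢ rep M s
      fresh a∈ e = <-irrefl (trans e (rep-≥ s ≤-refl)) (rep-< _ (loc-< a∈))
      sep′ : ∀ {n₁ i c n₂ j c′} → (n₁ , i , c) ∈ (n , L , s) ∷ A → (n₂ , j , c′) ∈ (n , L , s) ∷ A →
        rep M c ≡ rep M c′ → n₁ ≡ n₂ × Same n₁ i j
      sep′ (here refl) (here refl) e = refl , inj₁ refl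
      sep′ (here refl) (there b∈)  e = contradiction (sym e) (fresh b∈)
      sep′ (there a∈)  (here refl) e = contradiction e (fresh a∈)
      sep′ (there a∈)  (there b∈)  e = sep a∈ b∈ e
      uniq′ : ∀ {n₁ i c c′} → (n₁ , i , c) ∈ (n , L , s) ∷ A → (n₁ , i , c′) ∈ (n , L , s) ∷ A → c ≡ c′
      uniq′ (here refl) (here refl) = refl
      uniq′ (here refl) (there b∈)  = contradiction (∈-has b∈) (false≢true new)
      uniq′ (there a∈)  (here refl) = contradiction (∈-has a∈) (false≢true new)
      uniq′ (there a∈)  (there b∈)  = uniq a∈ b∈
      down′ : ∀ {n₁ i c} → (n₁ , suc i , c) ∈ (n , L , s) ∷ A → ∃ λ c′ → (n₁ , i , c′) ∈ (n , L , s) ∷ A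
      down′ (here refl) with c , a∈ ← has-∈ A (prev refl) = c , there a∈
      down′ (there a∈)  with c , b∈ ← down a∈ = c , there b∈

    -- The merges are `Mˢ s` rather than arbitrary, because `Agreement` refers to an actual stage of
    -- the construction.
    Inv-step : ∀ {s A D σ} → Inv s (Mˢ s) A D → Act s (Mˢ s) A D σ → Inv (suc s) (proj₁ σ) (proj₁ (proj₂ σ)) (proj₂ (proj₂ σ))
    Inv-step {s} {A} {D} I idle = record
      { rep-<  = λ { z (s≤s z≤s) → s≤s (rep-≤ I z≤s) }
      ; rep-≥  = λ z s<z → rep-≥ z (<⇒≤ s<z)
      ; loc-<  = λ a∈ → m<n⇒m<1+n (loc-< a∈)
      ; sep = sep ; uniq = uniq ; down = down ; done = done ; agreed = agreed }
      where open Inv I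
    Inv-step {s} {A} {D} I (merge n x y t n≤s y≤s φ n∉ free) = record
      { rep-<  = rep-<′
      ; rep-≥  = rep-≥′
      ; loc-<  = λ a∈ → m<n⇒m<1+n (loc-< (proj₁ (below-∈ A a∈)))
      ; sep    = λ a∈ b∈ e → sep (proj₁ (below-∈ A a∈)) (proj₁ (below-∈ A b∈))
                   (trans (sym (kept a∈)) (trans e (kept b∈)))
      ; uniq   = λ a∈ b∈ → uniq (proj₁ (below-∈ A a∈)) (proj₁ (below-∈ A b∈))
      ; down   = λ a∈ → let a∈A , le = below-∈ A a∈ ; c , b∈ = down a∈A in c , ∈-below b∈ le
      ; done   = λ { (here refl) → x , y , t , φ , merged
                   ; (there m∈) → let x , y , t , φ , e = done m∈ in x , y , t , φ , rep-cong _ M e }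
      ; agreed = λ a∈ → let a∈A , le = below-∈ A a∈ in agreement-map (λ b∈ → ∈-below b∈ le) (agreed a∈A)
      }
      where
      open Inv I
      M = Mˢ s
      open Merging I (rep-≤ I y≤s) (rep-≤ I (≤-trans (π₂≤ n) n≤s))
      M′ : Merges
      M′ = (rep M y , rep M (π₂ n)) ∷ M
      -- Every surviving location belongs to some m ≤ n, so `free` keeps it out of the class that
      -- moves.
      kept : ∀ {m i c} → (m , i , c) ∈ below n A → rep M′ c ≡ rep M c
      kept {c = c} a∈ = let a∈A , le = below-∈ A a∈ in rep-miss M c (free a∈A le)
      merged : rep M′ y ≡ rep M′ (π₂ n)
      merged with rep M (π₂ n) ≟ rep M y
      ... | yes e = rep-cong _ M (sym e)
      ... | no ne = trans (rep-hit M y refl) (sym (rep-miss M (π₂ n) ne))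
    Inv-step {s} {A} {D} I (copy n i c j c′ t a∈ b∈ k∈ x) = record
      { rep-<  = rep-<′
      ; rep-≥  = rep-≥′
      ; loc-<  = λ a∈ → m<n⇒m<1+n (loc-< a∈)
      ; sep    = sep′
      ; uniq   = uniq
      ; down   = down
      ; done   = λ m∈ → let x , y , t , φ , e = done m∈ in x , y , t , φ , rep-cong _ M e
      ; agreed = agreed
      }
      where
      open Inv I
      M = Mˢ s
      open Merging I {rep M c} {rep M c′} (rep-≤ I (<⇒≤ (loc-< a∈))) (rep-≤ I (<⇒≤ (loc-< b∈)))
      M′ : Merges
      M′ = (rep M c , rep M c′) ∷ M
      sep′ : ∀ {n₁ i₁ z n₂ i₂ w} → (n₁ , i₁ , z) ∈ A → (n₂ , i₂ , w) ∈ A → rep M′ z ≡ rep M′ w → n₁ ≡ n₂ × Same n₁ i₁ i₂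
      sep′ {z = z} {w = w} z∈ w∈ e with rep M z ≟ rep M c | rep M w ≟ rep M c
      ... | yes p | yes q = sep z∈ w∈ (trans p (sym q))
      ... | no  p | no  q = sep z∈ w∈ (trans (sym (rep-miss M z p)) (trans e (rep-miss M w q)))
      -- Only `z` moved, so `w` already lay in the class of `c′`; the indices are linked through the
      -- copied pair `i`, `j`.
      ... | yes p | no  q
        with refl , x₁ ← sep z∈ a∈ p
        with refl , x₂ ← sep b∈ w∈ (trans (sym (rep-hit M z p)) (trans e (rep-miss M w q)))
        = refl , Same-trans x₁ (Same-trans (inj₂ (k∈ , t , x)) x₂)
      sep′ {z = z} {w = w} z∈ w∈ e | no p | yes q
        with refl , x₁ ← sep w∈ a∈ q
        with refl , x₂ ← sep b∈ z∈ (trans (sym (rep-hit M w q)) (trans (sym e) (rep-miss M z p)))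
        = refl , Same-sym (Same-trans x₁ (Same-trans (inj₂ (k∈ , t , x)) x₂))
    Inv-step I (start n new) = Inv-alloc I n 0 new (λ ()) (λ ())
    Inv-step I (extend n L t c u c′ v L≤s k∈ prev new a∈ b∈ φ φ′ L≤t agr) =
      Inv-alloc I n (suc L) new (λ { refl → prev }) λ { refl → record
        { k∈ = k∈ ; c∈ = a∈ ; c′∈ = b∈ ; φc = φ ; φc′ = φ′ ; L≤t = L≤t ; L≤s = L≤s ; agree = agr } }

    inv : ∀ s → Inv s (Mˢ s) (Aˢ s) (Dˢ s)
    inv zero = record
      { rep-< = λ z () ; rep-≥ = λ z _ → refl ; loc-< = λ () ; sep = λ () ; uniq = λ () ; down = λ ()
      ; done = λ () ; agreed = λ () }
    inv (suc s) = Inv-step (inv s) (stage-Act s)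

-- Passing to the limit

¬∀⇒∃¬ : LEM → ∀ {A : Set} {P : A → Set} → ¬ (∀ x → P x) → ∃ λ x → ¬ P x
¬∀⇒∃¬ lem {P = P} h with lem {∃ λ x → ¬ P x}
... | yes e = e
... | no ne = contradiction (λ x → decidable-stable lem λ np → ne (x , np)) h

opaque
  repeated-class : ∀ {E : BinRel} → IsEquivalence E → (g : ℕ → ℕ) (Z : List ℕ) → (∀ x → Any (λ z → E z (g x)) Z) →
    ∃ λ x → ∃ λ y → x < y × E (g x) (g y)
  repeated-class {E} eq g Z cover
    with i , j , i<j , e ← pigeonhole {length Z} {suc (length Z)} ≤-refl (λ i → Any.index (cover (toℕ i)))
    = toℕ i , toℕ j , i<j , IsEquivalence.trans eq (IsEquivalence.sym eq (lookup-index (cover (toℕ i))))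
        (subst (λ k → E (List.lookup Z k) (g (toℕ j))) (sym e) (lookup-index (cover (toℕ j))))

record FiniteRange (E : BinRel) (f : ℕ → ℕ) : Set where
  constructor covers
  field
    Z     : List ℕ
    cover : ∀ x → Any (λ z → E z (f x)) Z

mergeAct-done : ∀ Ks {n x y t M A D} → out t (π₁ n) x y ≡ true → Unprotected M A n y →
  n ∈ proj₂ (proj₂ (Construction.mergeAct Ks n x y t (M , A , D)))
mergeAct-done Ks {n} {x} {y} {t} {M} {A} {D} φ free
  rewrite φ | false-hits {M} {A} {n} {y} free with mem n D in eq
... | true  = mem-∈ D eq
... | false = here refl

copyAct-merged : ∀ Ks {n i c j c′ t M A D} → (n , i , c) ∈ A → (n , j , c′) ∈ A → π₂ n ∈ Ks →
  halt t (π₂ (π₂ n)) i j ≡ true →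
  let M′ = proj₁ (Construction.copyAct Ks n i c j c′ t (M , A , D)) in rep M′ c ≡ rep M′ c′
copyAct-merged Ks {n} {i} {c} {j} {c′} {t} {M} {A} {D} a∈ b∈ k∈ x
  rewrite ∈-isLoc a∈ | ∈-isLoc b∈ | ∈-mem k∈ | x = merged
  where
  M′ : Merges
  M′ = (rep M c , rep M c′) ∷ M
  merged : rep M′ c ≡ rep M′ c′
  merged with rep M c′ ≟ rep M c
  ... | yes e = rep-cong _ M (sym e)
  ... | no ne = trans (rep-hit M c refl) (sym (rep-miss M c′ ne))

alloc-has : ∀ Ks {s n L M A D} → has n L (proj₁ (proj₂ (Construction.alloc Ks s n L (M , A , D)))) ≡ true
alloc-has Ks {s} {n} {L} {M} {A} {D} with has n L A in eq
... | true  = eq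
... | false = ∈-has {n} {L} {s} {(n , L , s) ∷ A} (here refl)

module Limit (lem : LEM) (Ks : List ℕ)
             (Dom-isEquivalence : ∀ k → k ∈ Ks → IsEquivalence (Dom (π₂ k)))
             (irreducible : ∀ k → k ∈ Ks → ¬ (Dom (π₂ k) ≤c Dom (π₁ k))) where

  open Construction Ks
  open WithEquivalences Dom-isEquivalence
  module ≈ = IsEquivalence E-isEquivalence

  -- A requirement that has been recorded as done stays so; excluded middle decides whether the next
  -- one ever will be.
  quiet : ∀ N → ∃ λ s₀ → ∀ {s} → s₀ ≤ s → ∀ m → m < N → m ∈ Dˢ (suc s) → m ∈ Dˢ s
  quiet zero = 0 , λ _ _ ()
  quiet (suc N) with quiet N | lem {∃ λ s → N ∈ Dˢ s}
  ... | s₀ , q | yes (s₁ , N∈) = s₀ ⊔ s₁ , λ {s} p m m<1+N m∈ →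
    case m≤n⇒m<n∨m≡n (≤-pred m<1+N) of λ
      { (inj₁ m<N)  → q (≤-trans (m≤m⊔n s₀ s₁) p) m m<N m∈
      ; (inj₂ refl) → done-mono (≤-trans (m≤n⊔m s₀ s₁) p) N∈ }
  ... | s₀ , q | no N∉ = s₀ , λ {s} p m m<1+N m∈ →
    case m≤n⇒m<n∨m≡n (≤-pred m<1+N) of λ
      { (inj₁ m<N)  → q p m m<N m∈
      ; (inj₂ refl) → contradiction (suc s , m∈) N∉ }

  PersistFrom : ℕ → ℕ → Set
  PersistFrom N s₀ = ∀ {s s′} → s₀ ≤ s → s ≤ s′ → ∀ {n i c} → n ≤ N → (n , i , c) ∈ Aˢ s → (n , i , c) ∈ Aˢ s′

  opaque
    persistence : ∀ N → ∃ (PersistFrom N)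
    persistence N = proj₁ (quiet N) , λ p p′ n≤N a∈ → go p (≤⇒≤′ p′) n≤N a∈
      where
      go : ∀ {s s′} → proj₁ (quiet N) ≤ s → s ≤′ s′ → ∀ {n i c} → n ≤ N → (n , i , c) ∈ Aˢ s → (n , i , c) ∈ Aˢ s′
      go p ≤′-refl n≤N a∈ = a∈
      go p (≤′-step p′) n≤N a∈ =
        Act-persist (stage-Act _) (proj₂ (quiet N) (≤-trans p (≤′⇒≤ p′))) n≤N (go p p′ n≤N a∈)

  -- A list that grows forever yields a reduction

  locationTest : ℕ → ℕ → Tm (nat ∷ nat ∷ []) bool
  -- `n` and `s₀` are literals, the finite information that makes the reduction computable. The
  -- number searched for packs a stage, a location, its output and a clock.
  locationTest n s₀ = and′ (leqn (lit s₀) (π₁′ v0))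
    (and′ (call loc′ (lit n ∷ v1 ∷ π₁′ (π₂′ v0) ∷ fst′ (snd′ (call stage′ (π₁′ v0 ∷ []))) ∷ []))
          (call out′ (π₂′ (π₂′ (π₂′ v0)) ∷ lit (π₁ n) ∷ π₁′ (π₂′ v0) ∷ π₁′ (π₂′ (π₂′ v0)) ∷ [])))

  record Located (n s₀ i s c u t : ℕ) : Set where
    constructor located
    field
      late : s₀ ≤ s
      loc∈ : (n , i , c) ∈ Aˢ s
      φ    : out t (π₁ n) c u ≡ true

  locationTest-sound : ∀ n s₀ {i S} → ⟦ locationTest n s₀ ⟧ (S ∷ i ∷ []) ≡ true →
    Located n s₀ i (π₁ S) (π₁ (π₂ S)) (π₁ (π₂ (π₂ S))) (π₂ (π₂ (π₂ S)))
  locationTest-sound n s₀ {i} {S} h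
    with h₁ , h ← ∧-true {s₀ ≤ᵇ π₁ S} h
    rewrite stage-eval (π₁ S)
    with h₂ , h₃ ← ∧-true {isLoc n i (π₁ (π₂ S)) (Aˢ (π₁ S))} h
    = located (≤ᵇ-true h₁) (isLoc-∈ (Aˢ (π₁ S)) h₂) h₃

  locationTest-complete : ∀ n s₀ {i s c u t} → Located n s₀ i s c u t →
    ⟦ locationTest n s₀ ⟧ (π s (π c (π u t)) ∷ i ∷ []) ≡ true
  locationTest-complete n s₀ {i} {s} {c} {u} {t} (located p a∈ φ)
    rewrite π₁-π s (π c (π u t)) | π₂-π s (π c (π u t)) | π₁-π c (π u t) | π₂-π c (π u t)
          | π₁-π u t | π₂-π u t | stage-eval s
    = true-∧ (true-≤ᵇ p) (true-∧ (∈-isLoc a∈) φ)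

  module Unbounded (n s₀ : ℕ) (persist : PersistFrom n s₀)
                   (unbounded : ∀ L → ∃ λ s → s₀ ≤ s × has n L (Aˢ s) ≡ true) where

    opaque
      agreement : ∀ L → ∃ λ s → s₀ ≤ s × Agreement n L (Aˢ s)
      agreement L with s , p , h ← unbounded (suc L) =
        s , p , Inv.agreed (inv s) (proj₂ (has-∈ (Aˢ s) h))

    opaque
      k∈Ks : π₂ n ∈ Ks
      k∈Ks = Agreement.k∈ (proj₂ (proj₂ (agreement 0)))

    opaque
      -- The pair `i`, `j` is up for comparison at every length `π (π i j) m`. That length is at
      -- least `m` and bounds stage and clock from below, so the comparison can be had as late as
      -- desired.
      at : ∀ i j m → ∃ λ s → s₀ ≤ s × ∃ λ s′ → ∃ λ c → ∃ λ c′ → ∃ λ u → ∃ λ v → ∃ λ t →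
        Located n s₀ i s c u t × Located n s₀ j s c′ v t × m ≤ s′ × m ≤ t ×
        (rep (Mˢ s′) c ≡ᵇ rep (Mˢ s′) c′) ≡ halt t (π₁ (π₂ n)) u v
      at i j m with s , p , a ← agreement (π (π i j) m) =
        s , p , Agreement.s a , Agreement.c a , Agreement.c′ a , Agreement.u a , Agreement.v a , Agreement.t a ,
        located p (subst (λ i → (n , i , Agreement.c a) ∈ Aˢ s) eqi (Agreement.c∈ a)) (Agreement.φc a) ,
        located p (subst (λ j → (n , j , Agreement.c′ a) ∈ Aˢ s) eqj (Agreement.c′∈ a)) (Agreement.φc′ a) ,
        ≤-trans (y≤π _ m) (Agreement.L≤s a) , ≤-trans (y≤π _ m) (Agreement.L≤t a) , Agreement.agree a
        where
        eqi : π₁ (π₁ (π (π i j) m)) ≡ i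
        eqi = trans (cong π₁ (π₁-π (π i j) m)) (π₁-π i j)
        eqj : π₂ (π₁ (π (π i j) m)) ≡ j
        eqj = trans (cong π₂ (π₁-π (π i j) m)) (π₂-π i j)

    same-location : ∀ {i s s′ c c′ u u′ t t′} → Located n s₀ i s c u t → Located n s₀ i s′ c′ u′ t′ → c ≡ c′ × u ≡ u′
    same-location {s = s} {s′} (located p a∈ φ) (located p′ b∈ φ′)
      with refl ← Inv.uniq (inv (s ⊔ s′)) (persist p (m≤m⊔n s s′) ≤-refl a∈) (persist p′ (m≤n⊔m s s′) ≤-refl b∈)
      = refl , out-unique φ φ′

    copied : ∀ {i j si sj ci cj ui uj ti tj} → Located n s₀ i si ci ui ti → Located n s₀ j sj cj uj tj →
      Dom (π₂ (π₂ n)) i j → E ci cj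
    copied {i} {j} {si} {sj} {ci} {cj} (located p a∈ _) (located p′ b∈ _) (t₀ , x) =
      suc S , subst (λ σ → rep (proj₁ σ) ci ≡ rep (proj₁ σ) cj) (sym (step-copy n i ci j cj t (stage S)))
        (copyAct-merged Ks {n} {i} {ci} {j} {cj} {t} {Mˢ S} {Aˢ S} {Dˢ S}
          (persist p (≤-trans (m≤n⇒m≤o⊔n t₀ (m≤m⊔n si sj)) t≤S) ≤-refl a∈)
          (persist p′ (≤-trans (m≤n⇒m≤o⊔n t₀ (m≤n⊔m si sj)) t≤S) ≤-refl b∈)
          k∈Ks (halt-mono (m≤m⊔n t₀ (si ⊔ sj)) x))
      where
      t S : ℕ
      -- Including `si ⊔ sj` in the clock pushes the proposing stage `S` beyond the stages at which
      -- the two locations are known.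
      t = t₀ ⊔ (si ⊔ sj)
      S = π 1 (π n (π (π i ci) (π (π j cj) t)))
      t≤S : t ≤ S
      t≤S = ≤-trans (y≤π (π j cj) t) (≤-trans (y≤π (π i ci) _) (≤-trans (y≤π n _) (y≤π 1 _)))

    -- Copying merges the two locations; a comparison made after that stage sees them equal and
    -- agrees, so the outputs are related.
    forth : ∀ {i j si sj ci cj ui uj ti tj} → Located n s₀ i si ci ui ti → Located n s₀ j sj cj uj tj →
      Dom (π₂ (π₂ n)) i j → Dom (π₁ (π₂ n)) ui uj
    forth {i} {j} ℓi ℓj x
      with s₃ , e ← copied ℓi ℓj x
      with _ , _ , _ , _ , _ , _ , _ , t , ℓ , ℓ′ , m≤s , _ , agr ← at i j s₃
      with refl , refl ← same-location ℓi ℓ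
      with refl , refl ← same-location ℓj ℓ′
      = t , trans (sym agr) (true-≡ᵇ (rep-mono m≤s e))

    -- A comparison with clock beyond `t₀` sees the outputs related, so the locations were in one
    -- class, and `sep` traces this back to the coded relation.
    back : ∀ {i j si sj ci cj ui uj ti tj} → Located n s₀ i si ci ui ti → Located n s₀ j sj cj uj tj →
      Dom (π₁ (π₂ n)) ui uj → Dom (π₂ (π₂ n)) i j
    back {i} {j} ℓi ℓj (t₀ , x)
      with s , p , s′ , _ , _ , _ , _ , t , ℓ , ℓ′ , _ , m≤t , agr ← at i j t₀
      with refl , refl ← same-location ℓi ℓ
      with refl , refl ← same-location ℓj ℓ′
      with Inv.sep (inv (s ⊔ s′)) (persist p (m≤m⊔n s s′) ≤-refl (Located.loc∈ ℓ)) (persist p (m≤m⊔n s s′) ≤-refl (Located.loc∈ ℓ′))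
             (rep-mono (m≤n⊔m s s′) (≡ᵇ-true (trans agr (halt-mono m≤t x))))
    ... | _ , inj₁ refl    = IsEquivalence.refl (Dom-isEquivalence (π₂ n) k∈Ks)
    ... | _ , inj₂ (_ , y) = y

    found : Σ (ℕ → ℕ) λ g → Computable g × (∀ i → ⟦ locationTest n s₀ ⟧ (g i ∷ i ∷ []) ≡ true)
    found = search (locationTest n s₀) λ i →
      let s , _ , _ , c , _ , u , _ , t , ℓ , _ = at i i 0 in π s (π c (π u t)) , locationTest-complete n s₀ ℓ

    opaque
      reduction : Dom (π₂ (π₂ n)) ≤c Dom (π₁ (π₂ n))
      reduction with g , g-computable , h ← found =
        (λ i → π₁ (π₂ (π₂ (g i)))) , ∘-computable (Tm-computable (π₁′ (π₂′ (π₂′ v0)))) g-computable , λ i j →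
        forth (locationTest-sound n s₀ (h i)) (locationTest-sound n s₀ (h j)) ,
        back (locationTest-sound n s₀ (h i)) (locationTest-sound n s₀ (h j))

  -- Finiteness of the lists and of the protected classes

  opaque
    -- Unboundedness itself puts `π₂ n` into `Ks`, since only such lists grow past their first
    -- entry; `irreducible` then forbids the reduction.
    bounded : ∀ {n s₀} → PersistFrom n s₀ → ∃ λ L → ∀ {s} → s₀ ≤ s → has n L (Aˢ s) ≢ true
    bounded {n} {s₀} persist
      with L , h ← ¬∀⇒∃¬ lem (λ u → irreducible (π₂ n) (Unbounded.k∈Ks n s₀ persist u) (Unbounded.reduction n s₀ persist u))
      = L , λ {s} p e → h (s , p , e)

  down* : ∀ s {n L i c} → L ≤′ i → (n , i , c) ∈ Aˢ s → ∃ λ c′ → (n , L , c′) ∈ Aˢ s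
  down* s ≤′-refl a∈ = _ , a∈
  down* s (≤′-step p) a∈ = down* s p (proj₂ (Inv.down (inv s) a∈))

  opaque
    initial-finite : ∀ {n s₀} → PersistFrom n s₀ → ∀ L → ∃ λ Z → ∀ {s} → s₀ ≤ s → ∀ {i c} → i < L → (n , i , c) ∈ Aˢ s → c ∈ Z
    initial-finite persist zero = [] , λ _ ()
    initial-finite {n} {s₀} persist (suc L) with initial-finite persist L | lem {∃ λ s → s₀ ≤ s × ∃ λ c → (n , L , c) ∈ Aˢ s}
    ... | Z , h | yes (s₁ , p₁ , c₁ , b∈) = c₁ ∷ Z , λ {s} p i<1+L a∈ → case m≤n⇒m<n∨m≡n (≤-pred i<1+L) of λ
      { (inj₁ i<L)  → there (h p i<L a∈)
      ; (inj₂ refl) → here (Inv.uniq (inv (s ⊔ s₁)) (persist p (m≤m⊔n s s₁) ≤-refl a∈) (persist p₁ (m≤n⊔m s s₁) ≤-refl b∈)) }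
    ... | Z , h | no none = Z , λ {s} p i<1+L a∈ → case m≤n⇒m<n∨m≡n (≤-pred i<1+L) of λ
      { (inj₁ i<L)  → h p i<L a∈
      ; (inj₂ refl) → contradiction (s , p , _ , a∈) none }

  opaque
    locations-finite : ∀ n → ∃ λ s₁ → ∃ λ Z → ∀ {s} → s₁ ≤ s → ∀ {i c} → (n , i , c) ∈ Aˢ s → c ∈ Z
    locations-finite n with L , none ← bounded (proj₂ (persistence n))
      with Z , h ← initial-finite (proj₂ (persistence n)) L
      = proj₁ (persistence n) , Z , λ {s} p {i} a∈ → case i <? L of λ
        { (yes i<L) → h p i<L a∈
        ; (no i≮L)  → contradiction (∈-has (proj₂ (down* s (≤⇒≤′ (≮⇒≥ i≮L)) a∈))) (none p) }

  opaque
    protected-finite : ∀ N → ∃ λ s₁ → ∃ λ Z → ∀ {s} → s₁ ≤ s → ∀ {n i c} → n < N → (n , i , c) ∈ Aˢ s → c ∈ Z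
    protected-finite zero = 0 , [] , λ _ ()
    protected-finite (suc N) with s₁ , Z , h ← protected-finite N | s₂ , Z′ , h′ ← locations-finite N
      = s₁ ⊔ s₂ , Z ++ Z′ , λ p n<1+N a∈ → case m≤n⇒m<n∨m≡n (≤-pred n<1+N) of λ
        { (inj₁ n<N)  → ∈-++⁺ˡ (h (≤-trans (m≤m⊔n s₁ s₂) p) n<N a∈)
        ; (inj₂ refl) → ∈-++⁺ʳ Z (h′ (≤-trans (m≤n⊔m s₁ s₂) p) a∈) }

  -- Meeting every class; darkness

  opaque
    meets-every-class : ∀ {f} → Computable f → ¬ FiniteRange E f → ∀ k → ∃ λ x → E (f x) k
    meets-every-class {f} (cf , hf) infinite k with lem {∃ λ s → π (code cf) k ∈ Dˢ s}
    ... | yes (s , n∈) with x , y , t , φ , e ← Inv.done (inv s) n∈ =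
      x , s , trans (cong (rep (Mˢ s)) (sym y≡fx)) (trans e (cong (rep (Mˢ s)) (π₂-π (code cf) k)))
      where
      y≡fx : y ≡ f x
      y≡fx = out-unique (subst (λ e → out t e x y ≡ true) (π₁-π (code cf) k) φ) (proj₂ (out-complete (hf x)))
    -- The successor includes the requirement's own locations, which it must spare as well.
    ... | no never with s₁ , Z , h ← protected-finite (suc (π (code cf) k))
      with x , x∉ ← ¬∀⇒∃¬ lem (infinite ∘ covers Z)
      with t₁ , φ ← out-complete (hf x)
      = contradiction (suc S , subst (λ σ → n ∈ proj₂ (proj₂ σ)) (sym (step-merge n x (f x) t (stage S)))
          (mergeAct-done Ks (subst (λ e → out t e x (f x) ≡ true) (sym (π₁-π (code cf) k)) (out-mono (m≤m⊔n t₁ s₁) φ))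
            λ a∈ n′≤n e → x∉ (lose (h s₁≤S (s≤s n′≤n) a∈) (S , e)))) never
      where
      n t S : ℕ
      n = π (code cf) k
      t = t₁ ⊔ s₁
      S = π 0 (π n (π x (π (f x) t)))
      s₁≤S : s₁ ≤ S
      s₁≤S = ≤-trans (m≤n⊔m t₁ s₁) (≤-trans (y≤π (f x) t) (≤-trans (y≤π x _) (≤-trans (y≤π n _) (y≤π 0 _))))

  opaque
    started : ∀ n {s₀} → ∃ λ s → s₀ ≤ s × ∃ λ c → (n , 0 , c) ∈ Aˢ s
    started n {s₀} = suc S , m≤n⇒m≤1+n (≤-trans (y≤π n s₀) (y≤π 2 _)) , has-∈ (Aˢ (suc S))
      (subst (λ σ → has n 0 (proj₁ (proj₂ σ)) ≡ true) (sym (step-start n s₀ (stage S)))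
        (alloc-has Ks {S} {n} {0} {Mˢ S} {Aˢ S} {Dˢ S}))
      where
      S : ℕ
      -- `s₀` fills the last component of the proposal, so that `S` lies beyond it.
      S = π 2 (π n s₀)

  opaque
    origin : ∀ n → ∃ λ c → ∃ λ s₁ → ∀ {s} → s₁ ≤ s → (n , 0 , c) ∈ Aˢ s
    origin n with s₀ , persist ← persistence n
      with s₁ , p , c , a∈ ← started n {s₀} = c , s₁ , λ p′ → persist p p′ ≤-refl a∈

  d : ℕ → ℕ
  d n = proj₁ (origin n)

  d-inequivalent : ∀ {m n} → E (d m) (d n) → m ≡ n
  d-inequivalent {m} {n} (s , e) with c , s₁ , h ← origin m | c′ , s₂ , h′ ← origin n
    = proj₁ (Inv.sep (inv (s ⊔ (s₁ ⊔ s₂))) (h (m≤n⇒m≤o⊔n s (m≤m⊔n s₁ s₂))) (h′ (m≤n⇒m≤o⊔n s (m≤n⊔m s₁ s₂)))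
        (rep-mono (m≤m⊔n s (s₁ ⊔ s₂)) e))

  infinitely-many-classes : InfinitelyManyClasses E
  infinitely-many-classes (Z , cover) with x , y , x<y , e ← repeated-class E-isEquivalence d Z (λ n → cover (d n))
    = <-irrefl (d-inequivalent e) x<y

  -- If `f` reduced equality, `f ∘ suc` would meet infinitely many classes and yet miss the class of
  -- `f 0`.
  E-dark : Dark E
  E-dark = infinitely-many-classes , λ (f , f-comp , h) →
    case lem {FiniteRange E (f ∘ suc)} of λ
      { (yes (covers Z cover)) →
          let x , y , x<y , e = repeated-class E-isEquivalence (f ∘ suc) Z cover
          in <-irrefl (suc-injective (proj₂ (h (suc x) (suc y)) e)) x<y
      ; (no infinite) →
          let x , e = meets-every-class (∘-computable f-comp (Tm-computable (suc′ v0))) infinite (f 0)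
          in case proj₂ (h (suc x) 0) e of λ () }

  -- Minimality

  preimageTest : ℕ → Tm (nat ∷ nat ∷ []) bool
  preimageTest e = and′ (call out′ (π₂′ (π₂′ (π₂′ v0)) ∷ lit e ∷ π₁′ v0 ∷ π₁′ (π₂′ v0) ∷ []))
    (call related′ (π₁′ (π₂′ (π₂′ v0)) ∷ π₁′ (π₂′ v0) ∷ v1 ∷ []))

  opaque
    preimageTest-complete : ∀ {f} ((cf , _) : Computable f) {k} → (∃ λ x → E (f x) k) →
      ∃ λ S → ⟦ preimageTest (code cf) ⟧ (S ∷ k ∷ []) ≡ true
    preimageTest-complete {f} (cf , hf) {k} (x , s , e) with t , φ ← out-complete (hf x) =
      π x (π (f x) (π s t)) , lemma
      where
      lemma : ⟦ preimageTest (code cf) ⟧ (π x (π (f x) (π s t)) ∷ k ∷ []) ≡ true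
      lemma rewrite π₁-π x (π (f x) (π s t)) | π₂-π x (π (f x) (π s t)) | π₁-π (f x) (π s t) | π₂-π (f x) (π s t)
                  | π₁-π s t | π₂-π s t | stage-eval s = true-∧ φ (true-≡ᵇ e)

  opaque
    preimageTest-sound : ∀ {f} ((cf , _) : Computable f) {S k} →
      ⟦ preimageTest (code cf) ⟧ (S ∷ k ∷ []) ≡ true → E (f (π₁ S)) k
    preimageTest-sound (cf , hf) {S} {k} h
      with φ , r ← ∧-true {out (π₂ (π₂ (π₂ S))) (code cf) (π₁ S) (π₁ (π₂ S))} h
      = s , trans (cong (rep (Mˢ s)) (sym (out-unique φ (proj₂ (out-complete (hf (π₁ S)))))))
                  (≡ᵇ-true (trans (sym (related-eval s (π₁ (π₂ S)) k)) r))
      where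
      s : ℕ
      s = π₁ (π₂ (π₂ S))

  opaque
    preimage-search : ∀ {f} → Computable f → (∀ k → ∃ λ x → E (f x) k) →
      Σ (ℕ → ℕ) λ g → Computable g × (∀ k → E (f (g k)) k)
    preimage-search f-comp@(cf , _) meets
      with g , g-comp , h ← search (preimageTest (code cf)) (λ k → preimageTest-complete f-comp (meets k))
      = (λ k → π₁ (g k)) , ∘-computable (Tm-computable (π₁′ v0)) g-comp , λ k → preimageTest-sound f-comp (h k)

  opaque
    minimal : ∀ {X} → ((f , _) : X ≤c E) → ¬ (E ≤c X) → FiniteRange E f
    minimal {X} (f , f-comp , h) E≰X with lem {FiniteRange E f}
    ... | yes finite = finite
    ... | no infinite with g , g-comp , fg ← preimage-search f-comp (meets-every-class f-comp infinite)
      = contradiction (g , g-comp , λ x y →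
          (λ e → proj₂ (h (g x) (g y)) (≈.trans (fg x) (≈.trans e (≈.sym (fg y))))) ,
          (λ e → ≈.trans (≈.sym (fg x)) (≈.trans (proj₁ (h (g x) (g y)) e) (fg y)))) E≰X

  -- Irreducibility to the given ceers

  opaque
    -- The stage that proposes the extension is dictated by the coding and only known to lie beyond
    -- `t`; hence `verdict` is required at all later stages.
    grow : ∀ {n s₀ s L c c′ u v t} → PersistFrom n s₀ → s₀ ≤ s → s ≤ t → π₂ n ∈ Ks → has n L (Aˢ s) ≡ true →
      (n , π₁ (π₁ L) , c) ∈ Aˢ s → (n , π₂ (π₁ L) , c′) ∈ Aˢ s →
      out t (π₁ n) c u ≡ true → out t (π₁ n) c′ v ≡ true → L ≤ t →
      (∀ {S} → t ≤ S → (rep (Mˢ S) c ≡ᵇ rep (Mˢ S) c′) ≡ halt t (π₁ (π₂ n)) u v) →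
      ∃ λ s′ → s₀ ≤ s′ × has n (suc L) (Aˢ s′) ≡ true
    grow {n} {s₀} {s} {L} {c} {c′} {u} {v} {t} persist p s≤t k∈ hasL a∈ b∈ φ φ′ L≤t verdict =
      suc S , m≤n⇒m≤1+n (≤-trans p s≤S) ,
      subst (λ σ → has n (suc L) (proj₁ (proj₂ σ)) ≡ true)
        (sym (step-extend n L t c u c′ v (stage S)
          (true-agreeing n L t c u c′ v (Mˢ S) (Aˢ S) (Dˢ S) k∈
            (∈-has (persist p s≤S ≤-refl (proj₂ (has-∈ (Aˢ s) hasL))))
            (persist p s≤S ≤-refl a∈) (persist p s≤S ≤-refl b∈) φ φ′ L≤t (verdict t≤S))))
        (alloc-has Ks {S} {n} {suc L} {Mˢ S} {Aˢ S} {Dˢ S})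
      where
      S : ℕ
      S = π 3 (π n (π L (π t (π (π c u) (π c′ v)))))
      t≤S : t ≤ S
      t≤S = ≤-trans (x≤π t _) (≤-trans (y≤π L _) (≤-trans (y≤π n _) (y≤π 3 _)))
      s≤S : s ≤ S
      s≤S = ≤-trans s≤t t≤S

  opaque
    -- For a true reduction `f` every comparison eventually succeeds, so the list of the requirement
    -- `π (code cf) k` would grow forever, against `bounded`.
    E≰Dom : ∀ k → k ∈ Ks → ¬ (E ≤c Dom (π₁ k))
    E≰Dom k k∈ (f , (cf , hf) , h) =
      let L , none = bounded (proj₂ (persistence n)) ; s , p , hasL = unbounded L in none p hasL
      where
      n s₀ : ℕ
      n = π (code cf) k
      s₀ = proj₁ (persistence n)
      verdicts : ∀ c c′ → ∃ λ t₀ → ∀ {S t} → t₀ ≤ S → t₀ ≤ t →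
        (rep (Mˢ S) c ≡ᵇ rep (Mˢ S) c′) ≡ halt t (π₁ k) (f c) (f c′)
      -- If the relation holds, it suffices to wait until both sides show it; if it fails, neither
      -- side ever shows it.
      verdicts c c′ with lem {E c c′}
      ... | yes (s₁ , e) with t₃ , x ← proj₁ (h c c′) (s₁ , e) = s₁ ⊔ t₃ , λ p q →
        trans (true-≡ᵇ (rep-mono (≤-trans (m≤m⊔n s₁ t₃) p) e)) (sym (halt-mono (≤-trans (m≤n⊔m s₁ t₃) q) x))
      ... | no ne = 0 , λ {S} {t} _ _ →
        trans (≢true λ e → ne (S , ≡ᵇ-true e)) (sym (≢true λ x → ne (proj₂ (h c c′) (t , x))))
      φ : ∀ c → ∃ λ t → out t (π₁ n) c (f c) ≡ true
      φ c with t , o ← out-complete (hf c) = t , subst (λ e → out t e c (f c) ≡ true) (sym (π₁-π (code cf) k)) o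
      unbounded : ∀ L → ∃ λ s → s₀ ≤ s × has n L (Aˢ s) ≡ true
      unbounded zero with s , p , c , a∈ ← started n {s₀} = s , p , ∈-has a∈
      unbounded (suc L) with s , p , hasL ← unbounded L
        with c , a∈ ← down* s (≤⇒≤′ (≤-trans (π₁≤ (π₁ L)) (π₁≤ L))) (proj₂ (has-∈ (Aˢ s) hasL))
        with c′ , b∈ ← down* s (≤⇒≤′ (≤-trans (π₂≤ (π₁ L)) (π₁≤ L))) (proj₂ (has-∈ (Aˢ s) hasL))
        with t₁ , o ← φ c | t₂ , o′ ← φ c′ | t₀ , verdict ← verdicts c c′
        = grow (proj₂ (persistence n)) p (≤-trans (m≤m⊔n s L) sL≤t) (subst (_∈ Ks) (sym (π₂-π (code cf) k)) k∈) hasL a∈ b∈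
            (out-mono (≤-trans (m≤m⊔n t₁ t₂) t₁₂≤t) o) (out-mono (≤-trans (m≤n⊔m t₁ t₂) t₁₂≤t) o′)
            (≤-trans (m≤n⊔m s L) sL≤t)
            (λ {S} t≤S → subst (λ k → (rep (Mˢ S) c ≡ᵇ rep (Mˢ S) c′) ≡ halt t (π₁ k) (f c) (f c′))
              (sym (π₂-π (code cf) k)) (verdict (≤-trans t₀≤t t≤S) t₀≤t))
        where
        t : ℕ
        t = (s ⊔ L) ⊔ ((t₁ ⊔ t₂) ⊔ t₀)
        sL≤t : s ⊔ L ≤ t
        sL≤t = m≤m⊔n (s ⊔ L) _
        t₁₂≤t : t₁ ⊔ t₂ ≤ t
        t₁₂≤t = m≤n⇒m≤o⊔n (s ⊔ L) (m≤m⊔n (t₁ ⊔ t₂) t₀)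
        t₀≤t : t₀ ≤ t
        t₀≤t = m≤n⇒m≤o⊔n (s ⊔ L) (m≤n⊔m (t₁ ⊔ t₂) t₀)

  -- Finite range and congruence modulo n

  opaque
    -- With one representative per class, equivalent images lead to equal representatives, whichever
    -- the search finds.
    dedupe : ∀ Z → ∃ λ Z′ → (∀ {a b} → a ∈ Z′ → b ∈ Z′ → E a b → a ≡ b) ×
      (∀ {y} → Any (λ z → E z y) Z → Any (λ z → E z y) Z′)
    dedupe [] = [] , (λ ()) , λ ()
    dedupe (z ∷ Z) with dedupe Z
    ... | Z′ , uniq , cover with lem {Any (E z) Z′}
    ...   | yes old = Z′ , uniq , λ
      { (here e)  → Any.map (λ e′ → ≈.trans (≈.sym e′) e) old
      ; (there m) → cover m }
    ...   | no new = z ∷ Z′ , uniq′ , λ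
      { (here e)  → here e
      ; (there m) → there (cover m) }
      where
      uniq′ : ∀ {a b} → a ∈ z ∷ Z′ → b ∈ z ∷ Z′ → E a b → a ≡ b
      uniq′ (here refl) (here refl) e = refl
      uniq′ (here refl) (there b∈)  e = contradiction (lose b∈ e) new
      uniq′ (there a∈)  (here refl) e = contradiction (lose a∈ (≈.sym e)) new
      uniq′ (there a∈)  (there b∈)  e = uniq a∈ b∈ e

  memberTest : ℕ → List ℕ → Tm (nat ∷ nat ∷ []) bool
  memberTest e Z = and′ (call mem′ (π₁′ v0 ∷ lit Z ∷ []))
    (and′ (call out′ (π₂′ (π₂′ (π₂′ v0)) ∷ lit e ∷ v1 ∷ π₁′ (π₂′ v0) ∷ []))
          (call related′ (π₁′ (π₂′ (π₂′ v0)) ∷ π₁′ v0 ∷ π₁′ (π₂′ v0) ∷ [])))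

  opaque
    memberTest-complete : ∀ {f} ((cf , _) : Computable f) {x Z} → Any (λ z → E z (f x)) Z →
      ∃ λ S → ⟦ memberTest (code cf) Z ⟧ (S ∷ x ∷ []) ≡ true
    memberTest-complete {f} (cf , hf) {x} {Z} cover with z , z∈ , s , e ← find cover | t , φ ← out-complete (hf x) =
      π z (π (f x) (π s t)) , lemma
      where
      lemma : ⟦ memberTest (code cf) Z ⟧ (π z (π (f x) (π s t)) ∷ x ∷ []) ≡ true
      lemma rewrite π₁-π z (π (f x) (π s t)) | π₂-π z (π (f x) (π s t)) | π₁-π (f x) (π s t) | π₂-π (f x) (π s t)
                  | π₁-π s t | π₂-π s t | stage-eval s = true-∧ (∈-mem z∈) (true-∧ φ (true-≡ᵇ e))

  opaque
    memberTest-sound : ∀ {f} ((cf , _) : Computable f) {S x Z} →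
      ⟦ memberTest (code cf) Z ⟧ (S ∷ x ∷ []) ≡ true → π₁ S ∈ Z × E (π₁ S) (f x)
    memberTest-sound (cf , hf) {S} {x} {Z} h
      with h₁ , h ← ∧-true {mem (π₁ S) Z} h
      with φ , r ← ∧-true {out (π₂ (π₂ (π₂ S))) (code cf) x (π₁ (π₂ S))} h
      = mem-∈ Z h₁ , s , trans (≡ᵇ-true (trans (sym (related-eval s (π₁ S) (π₁ (π₂ S)))) r))
                               (cong (rep (Mˢ s)) (out-unique φ (proj₂ (out-complete (hf x)))))
      where
      s : ℕ
      s = π₁ (π₂ (π₂ S))

  opaque
    member-search : ∀ {f} → Computable f → ∀ Z → (∀ x → Any (λ z → E z (f x)) Z) →
      Σ (ℕ → ℕ) λ g → Computable g × (∀ x → g x ∈ Z × E (g x) (f x))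
    member-search f-comp@(cf , _) Z cover
      with g , g-comp , h ← search (memberTest (code cf) Z) (λ x → memberTest-complete f-comp (cover x))
      = (λ x → π₁ (g x)) , ∘-computable (Tm-computable (π₁′ v0)) g-comp , λ x → memberTest-sound f-comp (h x)

  ≤-maximum : ∀ {z Z} → z ∈ Z → z ≤ foldr _⊔_ 0 Z
  ≤-maximum {Z = y ∷ Z} (here refl) = m≤m⊔n y _
  ≤-maximum {Z = y ∷ Z} (there z∈)  = m≤n⇒m≤o⊔n y (≤-maximum z∈)

  opaque
    finite-range⇒≤Idₙ : ∀ {X} → ((f , _) : X ≤c E) → FiniteRange E f → Σ ℕ λ n → Σ (NonZero n) λ nz → X ≤c Idₙ n {{nz}}
    finite-range⇒≤Idₙ {X} (f , f-comp , h) (covers Z cover)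
      with Z′ , uniq , cover′ ← dedupe Z
      with g , g-comp , hg ← member-search f-comp Z′ (λ x → cover′ (cover x))
      -- The modulus exceeds all representatives, so that reduction modulo it is injective on them;
      -- it need not be the number of classes.
      = suc (foldr _⊔_ 0 Z′) , _ , g , g-comp , λ x y →
        (λ e → cong (λ z → z % suc (foldr _⊔_ 0 Z′)) (uniq (proj₁ (hg x)) (proj₁ (hg y))
          (≈.trans (proj₂ (hg x)) (≈.trans (proj₁ (h x y) e) (≈.sym (proj₂ (hg y))))))) ,
        (λ e → proj₂ (h x y) (≈.trans (≈.sym (proj₂ (hg x)))
          (subst (λ z → E z (f y)) (sym (g-cancel (proj₁ ∘ hg) x y e)) (proj₂ (hg y)))))
      where
      g-cancel : ∀ {g : ℕ → ℕ} {Z′} → (∀ x → g x ∈ Z′) → ∀ x y → g x % suc (foldr _⊔_ 0 Z′) ≡ g y % suc (foldr _⊔_ 0 Z′) → g x ≡ g y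
      g-cancel g∈ x y e = trans (sym (m<n⇒m%n≡m (s≤s (≤-maximum (g∈ x))))) (trans e (m<n⇒m%n≡m (s≤s (≤-maximum (g∈ y)))))

-- Ceers given by codes, and the sequence

≤c-resp : ∀ {X X′ Y Y′ : BinRel} → (∀ x y → (X x y → X′ x y) × (X′ x y → X x y)) →
  (∀ x y → (Y x y → Y′ x y) × (Y′ x y → Y x y)) → X ≤c Y → X′ ≤c Y′
≤c-resp p q (f , f-comp , h) = f , f-comp , λ x y →
  (λ e → proj₁ (q (f x) (f y)) (proj₁ (h x y) (proj₂ (p x y) e))) ,
  (λ e → proj₁ (p x y) (proj₂ (h x y) (proj₂ (q (f x) (f y)) e)))

opaque
  Id-Ceer : Ceer Id
  Id-Ceer with c , h ← ∃-CE (eqn v1 v2) = isEquivalence , c , λ x y →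
    (λ e → proj₁ (h x y) (0 , trans (cong (x ≡ᵇ_) (sym e)) (≡ᵇ-refl x))) ,
    (λ d → ≡ᵇ-true (proj₂ (proj₂ (h x y) d)))

opaque
  Dom-code : ∀ {X : BinRel} ((c , _) : CE X) → ∀ x y → (X x y → Dom (code c) x y) × (Dom (code c) x y → X x y)
  Dom-code (c , h) x y =
    (λ e → halt-complete (proj₂ (proj₁ (h x y) e))) , (λ (t , d) → proj₂ (h x y) (halt-sound {t} d))

isEquivalence-resp : ∀ {X Y : BinRel} → (∀ x y → (X x y → Y x y) × (Y x y → X x y)) → IsEquivalence X → IsEquivalence Y
isEquivalence-resp p eq = record
  { refl  = λ {x} → proj₁ (p x x) (IsEquivalence.refl eq)
  ; sym   = λ {x} {y} e → proj₁ (p y x) (IsEquivalence.sym eq (proj₂ (p x y) e))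
  ; trans = λ {x} {y} {z} e e′ → proj₁ (p x z) (IsEquivalence.trans eq (proj₂ (p x y) e) (proj₂ (p y z) e′))
  }

-- k = π r x, where r is a code of R and x a code of a ceer not reducible to R.
record Witness (R : BinRel) (k : ℕ) : Set where
  field
    names       : ∀ x y → (Dom (π₁ k) x y → R x y) × (R x y → Dom (π₁ k) x y)
    equivalence : IsEquivalence (Dom (π₂ k))
    irreducible : ¬ (Dom (π₂ k) ≤c Dom (π₁ k))

opaque
  -- Excluded middle is applied to the existence of a code, because relations form a large type
  -- beyond `LEM`. Every ceer is the domain of a code, so failing to find one would make `R`
  -- universal.
  non-universal⇒Witness : LEM → ∀ {R} → Ceer R → ¬ Universal R → ∃ (Witness R)
  non-universal⇒Witness lem {R} (_ , ceR@(r , _)) nu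
    with lem {∃ λ (c : PR 2) → IsEquivalence (Dom (code c)) × ¬ (Dom (code c) ≤c Dom (code r))}
  ... | yes (c , eq , n) = π (code r) (code c) , record
    { names = subst (λ r → ∀ x y → (Dom r x y → R x y) × (R x y → Dom r x y)) (sym (π₁-π (code r) (code c)))
        λ x y → let p , q = Dom-code ceR x y in q , p
    ; equivalence = subst (λ x → IsEquivalence (Dom x)) (sym (π₂-π (code r) (code c))) eq
    ; irreducible = subst₂ (λ x r → ¬ (Dom x ≤c Dom r)) (sym (π₂-π (code r) (code c))) (sym (π₁-π (code r) (code c))) n }
  ... | no none = contradiction universal nu
    where
    universal : Universal R
    universal X (eqX , ceX@(c , _)) = ≤c-resp
      (λ x y → let p , q = Dom-code ceX x y in q , p) (λ x y → let p , q = Dom-code ceR x y in q , p)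
      (decidable-stable lem λ n → none (c , isEquivalence-resp (Dom-code ceX) eqX , n))

record Requirements : Set where
  field
    Ks          : List ℕ
    equivalence : ∀ k → k ∈ Ks → IsEquivalence (Dom (π₂ k))
    irreducible : ∀ k → k ∈ Ks → ¬ (Dom (π₂ k) ≤c Dom (π₁ k))

add : ∀ {R} → ∃ (Witness R) → Requirements → Requirements
add (k , w) q = record
  { Ks = k ∷ Requirements.Ks q
  ; equivalence = λ { _ (here refl) → Witness.equivalence w ; k (there k∈) → Requirements.equivalence q k k∈ }
  ; irreducible = λ { _ (here refl) → Witness.irreducible w ; k (there k∈) → Requirements.irreducible q k k∈ }
  }

dark⇒non-universal : ∀ {E} → Dark E → ¬ Universal E
dark⇒non-universal (_ , Id≰E) u = Id≰E (u Id Id-Ceer)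

module Sequence (lem : LEM) {R : BinRel} (wR : ∃ (Witness R)) where

  module L (q : Requirements) = Limit lem (Requirements.Ks q) (Requirements.equivalence q) (Requirements.irreducible q)

  Eᵠ : Requirements → BinRel
  Eᵠ q = Construction.E (Requirements.Ks q)

  Eᵠ-Ceer : ∀ q → Ceer (Eᵠ q)
  Eᵠ-Ceer q = Construction.E-isEquivalence (Requirements.Ks q) , Construction.E-CE (Requirements.Ks q)

  Eᵠ-Witness : ∀ q → ∃ (Witness (Eᵠ q))
  Eᵠ-Witness q = non-universal⇒Witness lem (Eᵠ-Ceer q) (dark⇒non-universal (L.E-dark q))

  requirements : ℕ → Requirements
  requirements zero    = add wR record { Ks = [] ; equivalence = λ _ () ; irreducible = λ _ () }
  requirements (suc l) = add (Eᵠ-Witness (requirements l)) (requirements l)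

  E : ℕ → BinRel
  E l = Eᵠ (requirements l)

  E≰ : ∀ {S} q → ((k , _) : ∃ (Witness S)) → k ∈ Requirements.Ks q → ¬ (Eᵠ q ≤c S)
  E≰ q (k , w) k∈ le = L.E≰Dom q k k∈
    (≤c-resp (λ _ _ → id , id) (λ x y → let p , q = Witness.names w x y in q , p) le)

  R∈ : ∀ l → proj₁ wR ∈ Requirements.Ks (requirements l)
  R∈ zero    = here refl
  R∈ (suc l) = there (R∈ l)

  E∈ : ∀ {l l′} → l <′ l′ → proj₁ (Eᵠ-Witness (requirements l)) ∈ Requirements.Ks (requirements l′)
  E∈ ≤′-refl     = here refl
  E∈ (≤′-step p) = there (E∈ p)

  later≰earlier : ∀ {l l′} → l < l′ → ¬ (E l′ ≤c E l)
  later≰earlier {l} {l′} p = E≰ (requirements l′) (Eᵠ-Witness (requirements l)) (E∈ (≤⇒≤′ p))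

  -- A reduction E l ≤ E l′ would be strict, hence have finite range by minimality of E l′.
  earlier≰later : ∀ {l l′} → l < l′ → ¬ (E l ≤c E l′)
  earlier≰later {l} {l′} p le@(f , _ , h)
    with covers Z cover ← L.minimal (requirements l′) le (later≰earlier p)
    with x , y , x<y , e ← repeated-class (proj₁ (Eᵠ-Ceer (requirements l′))) (f ∘ L.d (requirements l)) Z (λ n → cover _)
    = <-irrefl (L.d-inequivalent (requirements l) (proj₂ (h _ _) e)) x<y

theorem3p3 : LEM → (R : BinRel) → Ceer R → ¬ Universal R →
    Σ (ℕ → BinRel) λ E →
    (∀ l l′ → l ≢ l′ → ¬ (E l ≤c E l′)) ×
    (∀ l → Ceer (E l) × Dark (E l) × ¬ (E l ≤c R) ×
    (∀ (X : BinRel) → Ceer X → X <c E l →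
    Σ ℕ λ n → Σ (NonZero n) λ nz → X ≤c Idₙ n {{nz}}))
theorem3p3 lem R ceerR nu = E , incomparable , λ l →
  Eᵠ-Ceer (requirements l) , L.E-dark (requirements l) , E≰ (requirements l) wR (R∈ l) ,
  λ X _ (le , E≰X) → L.finite-range⇒≤Idₙ (requirements l) le (L.minimal (requirements l) le E≰X)
  where
  wR : ∃ (Witness R)
  wR = non-universal⇒Witness lem ceerR nu
  open Sequence lem wR
  incomparable : ∀ l l′ → l ≢ l′ → ¬ (E l ≤c E l′)
  incomparable l l′ l≢l′ with <-cmp l l′
  ... | tri< p _ _ = earlier≰later p
  ... | tri≈ _ e _ = contradiction e l≢l′
  ... | tri> _ _ p = later≰earlier p
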